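{- There exists $\Delta_0$ such that $\chi'_{\rm pOCF}(G)\le\Delta+2\log_2\Delta$ for every finite simple graph $G$ with maximum degree $\Delta\ge\Delta_0$ and minimum degree $\delta\ge\Delta-2\sqrt{\Delta}\,\log_2\Delta$.
   Context: For an edge colouring $c:E\to\mathbb{N}$ of a graph $G=(V,E)$ and an edge $uv$, the open neighbourhood of $uv$ is $E_G(uv)=(E_G(u)\cup E_G(v))\setminus\{uv\}$, where $E_G(x)$ is the set of edges incident with $x$; the edge $uv$ is satisfied if some colour appears on exactly one edge of $E_G(uv)$. An open conflict-free edge colouring is one in which every non-isolated edge is satisfied. $\chi'_{\rm pOCF}(G)$ is the minimum number of colours in an open conflict-free edge colouring of $G$ which is additionally proper (adjacent edges receive distinct colours). -}

module Defs where

open import Data.Nat using (ℕ; zero; suc; _+_; _*_; _∸_; _^_; _≤_; _<_)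
open import Data.Fin using (Fin; _≟_)
import Data.Fin as F
open import Data.Bool using (Bool; true; false; if_then_else_; not; _∧_)
open import Data.Product using (Σ; _×_; ∃)
open import Relation.Nullary using (¬_)
open import Relation.Nullary.Decidable using (⌊_⌋)
open import Relation.Binary.PropositionalEquality using (_≡_; _≢_)

count : ∀ {n} → (Fin n → Bool) → ℕ
count {zero}  f = 0
count {suc n} f = (if f F.zero then 1 else 0) + count (λ i → f (F.suc i))

record SimpleGraph (n : ℕ) : Set where
  field
    adj    : Fin n → Fin n → Bool
    sym    : ∀ u v → adj u v ≡ adj v u
    irrefl : ∀ u → adj u u ≡ false
open SimpleGraph public

Edge : ∀ {n} → SimpleGraph n → Fin n → Fin n → Set
Edge G u v = adj G u v ≡ true

degree : ∀ {n} → SimpleGraph n → Fin n → ℕ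
degree G u = count (adj G u)

IsMaxDegree : ∀ {n} → SimpleGraph n → ℕ → Set
IsMaxDegree G Δ = (∃ λ u → degree G u ≡ Δ) × (∀ u → degree G u ≤ Δ)

IsMinDegree : ∀ {n} → SimpleGraph n → ℕ → Set
IsMinDegree G δ = (∃ λ u → degree G u ≡ δ) × (∀ u → δ ≤ degree G u)

-- An edge colouring with colours Fin k: a function on ordered pairs which is
-- symmetric on edges (so it is a function on the unordered edges uv);
-- its values on non-edges are irrelevant.
IsEdgeColouring : ∀ {n k} → SimpleGraph n → (Fin n → Fin n → Fin k) → Set
IsEdgeColouring G c = ∀ u v → Edge G u v → c u v ≡ c v u

IsProper : ∀ {n k} → SimpleGraph n → (Fin n → Fin n → Fin k) → Set
IsProper G c = ∀ u v w → Edge G u v → Edge G u w → v ≢ w → c u v ≢ c u w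

-- Number of edges of the open neighbourhood E_G(uv) = (E(u) ∪ E(v)) \ {uv}
-- (for an edge uv, u ≠ v): edges uw with w ≠ v, plus edges vw with w ≠ u.
-- These two families are disjoint, so the sum counts E_G(uv) exactly.
nbhdSize : ∀ {n} → SimpleGraph n → Fin n → Fin n → ℕ
nbhdSize G u v =
  count (λ w → not ⌊ w ≟ v ⌋ ∧ adj G u w) + count (λ w → not ⌊ w ≟ u ⌋ ∧ adj G v w)

colourCount : ∀ {n k} → SimpleGraph n → (Fin n → Fin n → Fin k) → Fin n → Fin n → Fin k → ℕ
colourCount G c u v i =
  count (λ w → not ⌊ w ≟ v ⌋ ∧ adj G u w ∧ ⌊ c u w ≟ i ⌋)
  + count (λ w → not ⌊ w ≟ u ⌋ ∧ adj G v w ∧ ⌊ c v w ≟ i ⌋)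

Satisfied : ∀ {n k} → SimpleGraph n → (Fin n → Fin n → Fin k) → Fin n → Fin n → Set
Satisfied G c u v = ∃ λ i → colourCount G c u v i ≡ 1

IsOCF : ∀ {n k} → SimpleGraph n → (Fin n → Fin n → Fin k) → Set
IsOCF G c = ∀ u v → Edge G u v → ¬ (nbhdSize G u v ≡ 0) → Satisfied G c u v

POCFColourable : ∀ {n} → SimpleGraph n → ℕ → Set
POCFColourable G k =
  Σ (_ → _ → Fin k) λ c → IsEdgeColouring G c × IsProper G c × IsOCF G c

-- Real-free encodings (exact for Δ ≥ 1):
-- k ≤ Δ + 2 log₂ Δ   ⟺   2^(k ∸ Δ) ≤ Δ².
WithinBound : ℕ → ℕ → Set
WithinBound Δ k = 2 ^ (k ∸ Δ) ≤ Δ ^ 2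

-- δ ≥ Δ − 2 √Δ log₂ Δ  ⟺  t := Δ ∸ δ satisfies t/(2√Δ) ≤ log₂ Δ
-- ⟺ every rational a/b < t/(2√Δ)  (i.e. 4Δa² < t²b²) has a/b ≤ log₂ Δ (i.e. 2^a ≤ Δ^b).
MinDegreeCond : ℕ → ℕ → Set
MinDegreeCond Δ δ =
  ∀ a b → 0 < b → 4 * Δ * (a * a) < ((Δ ∸ δ) * (Δ ∸ δ)) * (b * b) → 2 ^ a ≤ Δ ^ b

{-# OPTIONS --safe #-}

-- In a proper colouring the edge uv is satisfied as soon as the sets of colours seen at u and at v
-- differ.  Choose s with 2^(3s+3) ≤ Δ < 2^(3s+6).  By Vizing's theorem G has a proper colouring c with
-- Δ + 1 colours.  As all degrees are at least 2Δ/3, there is a subgraph F whose degrees lie between 4s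
-- and 6s + 3, and F has a proper colouring x with 6s + 4 further colours.  Recolour every edge of F
-- independently with probability 1/2 from c to x.  An edge uv of G is bad if the further colours seen
-- at u and at v coincide apart from uv itself; since the recoloured edges at v are then determined by
-- the others, this has probability at most 2^(1-4s), and it depends on O(sΔ) other such events only.
-- As 2^(4s) is about Δ^(4/3), the local lemma yields a choice with no bad edge.

module Submission where

open import Defs hiding (sym)
open import Data.Nat as ℕ using (ℕ; zero; suc; _+_; _*_; _∸_; _^_; _≤_; _<_; z≤n; s≤s)
open import Data.Nat.DivMod using (m≡m%n+[m/n]*n; m%n<n)
open import Data.Nat.Properties hiding (_≟_; suc-injective; 0≢1+n)
open import Data.Nat.Tactic.RingSolver using (solve-∀)
open import Data.Fin as Fin using (Fin; zero; suc; toℕ; fromℕ<; _≟_; combine; remQuot; _↑ˡ_; _↑ʳ_)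
open import Data.Fin.Patterns using (0F; 1F; 2F)
open import Data.Fin.Permutation.Components using (transpose)
open import Data.Fin.Properties using (suc-injective; 0≢1+n; any?; toℕ<n; toℕ-injective; toℕ-fromℕ<;
  combine-remQuot; remQuot-combine; combine-injective; combine-injectiveˡ;
  splitAt-↑ˡ; splitAt-↑ʳ; ↑ˡ-injective; ↑ʳ-injective)
open import Data.Bool as Bool using (Bool; true; false; if_then_else_; not; _∧_; _∨_; _xor_)
open import Data.Bool.Properties using (∧-comm; ∧-assoc; ∧-zeroʳ; xor-comm; xor-same; not-distribˡ-xor)
open import Data.Maybe using (Maybe; just; nothing; is-just; fromMaybe; map)
open import Data.Maybe.Properties using (≡-dec; just-injective)
open import Data.Vec using (Vec; []; _∷_; lookup; updateAt)
open import Data.Vec.Properties using (lookup∘updateAt; lookup∘updateAt′)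
open import Data.Product using (Σ; ∃; _×_; _,_; proj₁; proj₂)
open import Data.Sum using (_⊎_; inj₁; inj₂; swap)
open import Data.Empty using (⊥; ⊥-elim)
open import Function using (_∘_)
open import Relation.Nullary using (¬_; Dec; yes; no)
open import Relation.Nullary.Decidable using (⌊_⌋; _×-dec_; _⊎-dec_)
open import Relation.Binary.PropositionalEquality
open import Algebra.Properties.CommutativeMonoid.Sum +-0-commutativeMonoid
  using (sum; ∑-comm; ∑-distrib-+; sum-cong-≗)

-- The two palettes are disjoint and `c`, `x` are proper, so every outcome of the coins is a proper
-- colouring; the coins have to secure satisfaction alone. The budget shapes `F`. Beyond the Δ + 1
-- colours of `c` only about 6s more are allowed, while the local lemma has to beat Δ < 2^(3s+6) and
-- so wants clearly more than 3s coins at every vertex. Hence the maximum degree of `F` has to stay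
-- below about twice its minimum degree. The ratio 3 to 2 comes from Vizing's theorem once more:
-- each vertex of G is split into three of degree at most m = ⌈Δ/3⌉, two of them of degree exactly
-- m, which requires degrees of G between 2m and 3m. This is where the minimum degree hypothesis
-- enters. For the bad event at uv the palette at u is regarded as given and the coins at v are
-- tossed afterwards. What this yields is a bound on a conditional probability, so the local lemma
-- is used in its lopsided form, where only events reading a coin at v count as neighbours.
-- Probabilities are numbers of bit vectors with denominators cleared.

private
  variable
    m n K M L : ℕ

-- Booleans and decisions

∧-true : ∀ {a b} → a ≡ true → b ≡ true → a ∧ b ≡ true
∧-true refl refl = refl

∧-trueˡ : ∀ {a b} → a ∧ b ≡ true → a ≡ true
∧-trueˡ {true} _ = refl

∧-trueʳ : ∀ {a b} → a ∧ b ≡ true → b ≡ true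
∧-trueʳ {true} p = p

∨-trueˡ : ∀ {a b} → a ≡ true → a ∨ b ≡ true
∨-trueˡ refl = refl

∨-trueʳ : ∀ {a b} → b ≡ true → a ∨ b ≡ true
∨-trueʳ {false} refl = refl
∨-trueʳ {true}  refl = refl

not-true : ∀ {a} → not a ≡ true → a ≡ false
not-true {false} _ = refl

false≢true : ∀ {a} {A : Set} → a ≡ false → a ≡ true → A
false≢true refl ()

≢true⇒false : ∀ {a} → a ≢ true → a ≡ false
≢true⇒false {false} _ = refl
≢true⇒false {true}  p = ⊥-elim (p refl)

bool-ext : ∀ {a b} → (a ≡ true → b ≡ true) → (b ≡ true → a ≡ true) → a ≡ b
bool-ext {true}  {b}     f g = sym (f refl)
bool-ext {false} {true}  f g = g refl
bool-ext {false} {false} f g = refl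

true⇒ : ∀ {A : Set} {d : Dec A} → ⌊ d ⌋ ≡ true → A
true⇒ {d = yes a} _ = a

⇒true : ∀ {A : Set} {d : Dec A} → A → ⌊ d ⌋ ≡ true
⇒true {d = yes _} _ = refl
⇒true {d = no ¬a} a = ⊥-elim (¬a a)

⇒false : ∀ {A : Set} {d : Dec A} → ¬ A → ⌊ d ⌋ ≡ false
⇒false {d = yes a} ¬a = ⊥-elim (¬a a)
⇒false {d = no _}  _  = refl

-- Counting and summing over Fin n

count-cong : {f g : Fin n → Bool} → (∀ i → f i ≡ g i) → count f ≡ count g
count-cong {zero}  e = refl
count-cong {suc n} e = cong₂ (λ b c → (if b then 1 else 0) + c) (e zero) (count-cong (e ∘ suc))

count-mono : (f g : Fin n → Bool) → (∀ i → f i ≡ true → g i ≡ true) → count f ≤ count g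
count-mono {zero} f g h = z≤n
count-mono {suc n} f g h with f zero in ef | g zero in eg
... | false | false = count-mono (f ∘ suc) (g ∘ suc) (h ∘ suc)
... | false | true  = m≤n⇒m≤1+n (count-mono (f ∘ suc) (g ∘ suc) (h ∘ suc))
... | true  | true  = s≤s (count-mono (f ∘ suc) (g ∘ suc) (h ∘ suc))
... | true  | false = false≢true eg (h zero ef)

count-split : (f g : Fin n → Bool) →
              count f ≡ count (λ i → f i ∧ g i) + count (λ i → f i ∧ not (g i))
count-split {zero}  f g = refl
count-split {suc n} f g with f zero | g zero
... | false | _     = count-split (f ∘ suc) (g ∘ suc)
... | true  | true  = cong suc (count-split (f ∘ suc) (g ∘ suc))
... | true  | false = trans (cong suc (count-split (f ∘ suc) (g ∘ suc))) (sym (+-suc _ _))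

count-none : {f : Fin n → Bool} → (∀ i → f i ≡ false) → count f ≡ 0
count-none {zero} h = refl
count-none {suc n} {f} h rewrite h zero = count-none (h ∘ suc)

count-all : {f : Fin n → Bool} → (∀ i → f i ≡ true) → count f ≡ n
count-all {zero} h = refl
count-all {suc n} {f} h rewrite h zero = cong suc (count-all (h ∘ suc))

remove : (Fin n → Bool) → Fin n → Fin n → Bool
remove f a i = not ⌊ i ≟ a ⌋ ∧ f i

remove-⊆ : (f : Fin n → Bool) (a : Fin n) {i : Fin n} → remove f a i ≡ true → f i ≡ true
remove-⊆ f a = ∧-trueʳ

remove-≢ : (f : Fin n → Bool) (a : Fin n) {i : Fin n} → remove f a i ≡ true → i ≢ a
remove-≢ f a {i} p q with i ≟ a
remove-≢ f a () q | yes _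
remove-≢ f a p q  | no ¬e = ¬e q

remove-intro : (f : Fin n → Bool) (a : Fin n) {i : Fin n} → f i ≡ true → i ≢ a → remove f a i ≡ true
remove-intro f a {i} p q with i ≟ a
... | yes e = ⊥-elim (q e)
... | no _  = p

remove-suc : (f : Fin (suc n) → Bool) (a j : Fin n) → remove (f ∘ suc) a j ≡ remove f (suc a) (suc j)
remove-suc f a j with j ≟ a
... | yes _ = refl
... | no _  = refl

count-remove : (a : Fin n) (f : Fin n → Bool) → f a ≡ true → count f ≡ suc (count (remove f a))
count-remove {suc n} zero f p rewrite p = cong suc (count-cong {n} (λ _ → refl))
count-remove {suc n} (suc a) f p with f zero
... | true  = cong suc (trans (count-remove a (f ∘ suc) p) (cong suc (count-cong (remove-suc f a))))
... | false = trans (count-remove a (f ∘ suc) p) (cong suc (count-cong (remove-suc f a)))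

count-remove-≤ : (a : Fin n) (f : Fin n → Bool) → count f ≤ suc (count (remove f a))
count-remove-≤ a f with f a in e
... | true  = ≤-reflexive (count-remove a f e)
... | false = m≤n⇒m≤1+n (count-mono f (remove f a)
                (λ i p → remove-intro f a p (λ { refl → false≢true e p })))

0<count : {f : Fin n → Bool} (i : Fin n) → f i ≡ true → 0 < count f
0<count {f = f} i p rewrite count-remove i f p = s≤s z≤n

∃-of-count : (f : Fin n → Bool) → 0 < count f → ∃ λ i → f i ≡ true
∃-of-count {suc n} f h with f zero in e
... | true  = zero , e
... | false with ∃-of-count (f ∘ suc) h
...   | i , p = suc i , p

count-inject : (f : Fin m → Bool) (g : Fin n → Bool) (φ : ∀ i → f i ≡ true → Fin n) →
               (∀ i p → g (φ i p) ≡ true) → (∀ i j p q → φ i p ≡ φ j q → i ≡ j) →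
               count f ≤ count g
count-inject {zero} f g φ h inj = z≤n
count-inject {suc m} f g φ h inj with f zero in e
... | false = count-inject (f ∘ suc) g (φ ∘ suc) (h ∘ suc)
                (λ i j p q r → suc-injective (inj (suc i) (suc j) p q r))
... | true = subst (suc (count (f ∘ suc)) ≤_) (sym (count-remove (φ zero e) g (h zero e)))
               (s≤s (count-inject (f ∘ suc) (remove g (φ zero e)) (φ ∘ suc)
                 (λ i p → remove-intro g (φ zero e) (h (suc i) p) (λ r → 0≢1+n (sym (inj (suc i) zero p e r))))
                 (λ i j p q r → suc-injective (inj (suc i) (suc j) p q r))))

count-unique : (f : Fin n → Bool) → (∀ i j → f i ≡ true → f j ≡ true → i ≡ j) → count f ≤ 1
count-unique f h = count-inject {n = 1} f (λ _ → true) (λ _ _ → zero) (λ _ _ → refl)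
                     (λ i j p q _ → h i j p q)

count≡1 : (f : Fin n → Bool) (a : Fin n) → f a ≡ true → (∀ i → f i ≡ true → i ≡ a) → count f ≡ 1
count≡1 f a p h = ≤-antisym (count-unique f (λ i j q r → trans (h i q) (sym (h j r)))) (0<count a p)

count≡1-unique : (f : Fin n → Bool) → count f ≡ 1 → ∀ {i j} → f i ≡ true → f j ≡ true → i ≡ j
count≡1-unique f e {i} {j} p q with i ≟ j
... | yes r = r
... | no r with subst (0 <_) (cong (_∸ 1) (trans (sym (count-remove j f q)) e)) (0<count i (remove-intro f j p r))
... | ()

subset-of-size : (f : Fin n → Bool) (k : ℕ) → k ≤ count f →
                 ∃ λ g → (∀ i → g i ≡ true → f i ≡ true) × count g ≡ k
subset-of-size {n} f zero h = (λ _ → false) , (λ _ ()) , count-none {n} (λ _ → refl)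
subset-of-size {suc n} f (suc k) h with f zero in e
... | true  with subset-of-size (f ∘ suc) k (≤-pred h)
...   | g , s , c = (λ { zero → true ; (suc i) → g i }) , (λ { zero _ → e ; (suc i) → s i }) , cong suc c
subset-of-size {suc n} f (suc k) h | false with subset-of-size (f ∘ suc) (suc k) h
...   | g , s , c = (λ { zero → false ; (suc i) → g i }) , (λ { (suc i) → s i }) , c

enumerate : (f : Fin n → Bool) → ∃ λ (e : Fin (count f) → Fin n) →
            (∀ i → f (e i) ≡ true) × (∀ i j → e i ≡ e j → i ≡ j)
enumerate {zero} f = (λ ()) , (λ ()) , (λ ())
enumerate {suc n} f with f zero in eq | enumerate (f ∘ suc)
... | false | e , s , i = suc ∘ e , s , (λ a b p → i a b (suc-injective p))
... | true  | e , s , i = (λ { zero → zero ; (suc a) → suc (e a) })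
                        , (λ { zero → eq ; (suc a) → s a })
                        , (λ { zero zero _ → refl ; (suc a) (suc b) p → cong suc (i a b (suc-injective p)) })

sum-mono : {f g : Fin n → ℕ} → (∀ i → f i ≤ g i) → sum f ≤ sum g
sum-mono {zero} h = z≤n
sum-mono {suc n} h = +-mono-≤ (h zero) (sum-mono (h ∘ suc))

sum-if : (f : Fin n → Bool) (c : ℕ) → sum (λ i → if f i then c else 0) ≡ count f * c
sum-if {zero} f c = refl
sum-if {suc n} f c with f zero
... | true  = cong (c +_) (sum-if (f ∘ suc) c)
... | false = sum-if (f ∘ suc) c

count-as-sum : (f : Fin n → Bool) → count f ≡ sum (λ i → if f i then 1 else 0)
count-as-sum f = sym (trans (sum-if f 1) (*-identityʳ _))

∑count-comm : (f : Fin m → Fin n → Bool) →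
              sum (λ i → count (f i)) ≡ sum (λ j → count (λ i → f i j))
∑count-comm f = trans (sum-cong-≗ (λ i → count-as-sum (f i)))
  (trans (∑-comm (λ i j → if f i j then 1 else 0)) (sum-cong-≗ (λ j → sym (count-as-sum (λ i → f i j)))))

sum-<⇒∃< : (f g : Fin n → ℕ) → sum f < sum g → ∃ λ i → f i < g i
sum-<⇒∃< {suc n} f g h with f zero <? g zero
... | yes p = zero , p
... | no p with sum-<⇒∃< (f ∘ suc) (g ∘ suc)
                  (+-cancelˡ-< (g zero) _ _ (≤-<-trans (+-monoˡ-≤ _ (≮⇒≥ p)) h))
...   | i , q = suc i , q

odd : ℕ → Bool
odd zero    = false
odd (suc n) = not (odd n)

odd-+ : ∀ a b → odd (a + b) ≡ odd a xor odd b
odd-+ zero b = refl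
odd-+ (suc a) b = trans (cong not (odd-+ a b)) (not-distribˡ-xor (odd a) (odd b))

odd-sum : (f : Fin n → ℕ) → odd (sum f) ≡ true → ∃ λ i → odd (f i) ≡ true
odd-sum {suc n} f h with odd (f zero) in e
... | true  = zero , e
... | false with odd-sum (f ∘ suc) (trans (sym (trans (odd-+ (f zero) _) (cong (_xor odd (sum (f ∘ suc))) e))) h)
...   | i , p = suc i , p

count-++ : ∀ m {k} (f : Fin (m + k) → Bool) →
           count f ≡ count (λ i → f (i ↑ˡ k)) + count (λ j → f (m ↑ʳ j))
count-++ zero f = refl
count-++ (suc m) f = trans (cong ((if f zero then 1 else 0) +_) (count-++ m (f ∘ suc)))
                           (sym (+-assoc (if f zero then 1 else 0) _ _))

count-combine : ∀ m {k} (f : Fin (m * k) → Bool) →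
                count f ≡ sum (λ i → count (λ j → f (combine {m} i j)))
count-combine zero f = refl
count-combine (suc m) {k} f = trans (count-++ k f)
  (cong (count (λ i → f (i ↑ˡ m * k)) +_) (count-combine m (λ j → f (k ↑ʳ j))))

count-∨ : (f g : Fin n → Bool) → count (λ i → f i ∨ g i) ≤ count f + count g
count-∨ {zero} f g = z≤n
count-∨ {suc n} f g with f zero | g zero
... | false | false = count-∨ (f ∘ suc) (g ∘ suc)
... | false | true  = ≤-trans (s≤s (count-∨ (f ∘ suc) (g ∘ suc))) (≤-reflexive (sym (+-suc _ _)))
... | true  | false = s≤s (count-∨ (f ∘ suc) (g ∘ suc))
... | true  | true  = s≤s (≤-trans (count-∨ (f ∘ suc) (g ∘ suc)) (+-monoʳ-≤ _ (n≤1+n _)))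

sum-count-≤ : (t : Fin m → Bool) (f : Fin m → Fin n → Bool) (d : ℕ) → (∀ i → count (f i) ≤ d) →
              sum (λ i → count (λ j → t i ∧ f i j)) ≤ count t * d
sum-count-≤ t f d h = ≤-trans (sum-mono term) (≤-reflexive (sum-if t d))
  where
  term : ∀ i → count (λ j → t i ∧ f i j) ≤ (if t i then d else 0)
  term i with t i
  ... | true  = h i
  ... | false = ≤-reflexive (count-none {f = λ j → false ∧ f i j} (λ _ → refl))

-- Vizing's theorem

-- No graph is recorded: the coloured edges are the pairs on which `col` is `just`, so the colouring
-- of a part and that of the whole have the same type.
record PartialColouring (n K : ℕ) : Set where
  field
    col        : Fin n → Fin n → Maybe (Fin K)
    col-sym    : ∀ u w → col u w ≡ col w u
    col-proper : ∀ {u v w i} → col u v ≡ just i → col u w ≡ just i → v ≡ w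
open PartialColouring

Has : PartialColouring n K → Fin n → Fin K → Set
Has C u i = ∃ λ w → col C u w ≡ just i

has? : (C : PartialColouring n K) → ∀ u i → Dec (Has C u i)
has? C u i = any? (λ w → ≡-dec _≟_ (col C u w) (just i))

-- Kempe chains and Kempe changes

transposeˡ : ∀ (i j : Fin K) → transpose i j i ≡ j
transposeˡ i j with i ≟ i
... | yes _ = refl
... | no p  = ⊥-elim (p refl)

transposeʳ : ∀ (i j : Fin K) → transpose i j j ≡ i
transposeʳ i j with j ≟ i
... | yes p = p
... | no _ with j ≟ j
...   | yes _ = refl
...   | no p  = ⊥-elim (p refl)

transpose-≢ : ∀ {i j x : Fin K} → x ≢ i → x ≢ j → transpose i j x ≡ x
transpose-≢ {i = i} {j} {x} p q with x ≟ i
... | yes r = ⊥-elim (p r)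
... | no _ with x ≟ j
...   | yes r = ⊥-elim (q r)
...   | no _  = refl

transpose-involutive : ∀ (i j x : Fin K) → transpose i j (transpose i j x) ≡ x
transpose-involutive i j x = helper (x ≟ i) (x ≟ j)
  where
  helper : Dec (x ≡ i) → Dec (x ≡ j) → transpose i j (transpose i j x) ≡ x
  helper (yes refl) _ rewrite transposeˡ i j = transposeʳ i j
  helper (no _) (yes refl) rewrite transposeʳ i j = transposeˡ i j
  helper (no p) (no q) rewrite transpose-≢ p q = transpose-≢ p q

-- Stands in for the path of colours `i` and `j` that starts at `a`. Two properties suffice: no edge
-- of either colour leaves the set, so the two colours can be exchanged on it, and at most two of
-- its members, `a` and `end`, can miss one of them.
record Chain (C : PartialColouring n K) (i j : Fin K) (a : Fin n) : Set where
  field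
    mem    : Fin n → Bool
    start  : mem a ≡ true
    closed : ∀ u w → col C u w ≡ just i ⊎ col C u w ≡ just j → mem u ≡ true → mem w ≡ true
    end    : Fin n
    inner  : ∀ u → mem u ≡ true → u ≢ a → u ≢ end → Has C u i × Has C u j

chain-swap : ∀ {C : PartialColouring n K} {i j a} → Chain C i j a → Chain C j i a
chain-swap ch = record
  { mem = mem ; start = start ; closed = λ u w → closed u w ∘ swap ; end = end
  ; inner = λ u p q r → let (x , y) = inner u p q r in y , x }
  where open Chain ch

-- The visited set M is extended from its last vertex w along colour i; if the next vertex is
-- already visited then M is closed, so it need not be shown that this cannot happen.
grow : (C : PartialColouring n K) (i j : Fin K) (a : Fin n) (fuel : ℕ)
       (M : Fin n → Bool) (w : Fin n) → n < count M + fuel →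
       M a ≡ true → M w ≡ true →
       (∀ u z → M u ≡ true → u ≢ w → col C u z ≡ just i ⊎ col C u z ≡ just j → M z ≡ true) →
       (∀ z → col C w z ≡ just j → M z ≡ true) →
       (∀ u → M u ≡ true → u ≢ a → u ≢ w → Has C u i × Has C u j) →
       (w ≢ a → Has C w j) →
       Chain C i j a
grow {n} C i j a zero M w h _ _ _ _ _ _ =
  ⊥-elim (<⇒≱ (subst (n <_) (+-identityʳ _) h)
    (subst (count M ≤_) (count-all {n} {λ _ → true} (λ _ → refl)) (count-mono M (λ _ → true) (λ _ _ → refl))))
grow {n} C i j a (suc fuel) M w h Ma Mw inside entry both hasj with has? C w i
... | no ¬has = record
  { mem = M ; start = Ma ; end = w ; inner = both
  ; closed = λ u z c Mu → cl u z c Mu (u ≟ w) }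
  where
  cl : ∀ u z → col C u z ≡ just i ⊎ col C u z ≡ just j → M u ≡ true → Dec (u ≡ w) → M z ≡ true
  cl u z (inj₁ c) Mu (yes refl) = ⊥-elim (¬has (z , c))
  cl u z (inj₂ c) Mu (yes refl) = entry z c
  cl u z c Mu (no ne) = inside u z Mu ne c
... | yes (w' , cw) with M w' in Mw'
...   | true = record
  { mem = M ; start = Ma ; end = w ; inner = both
  ; closed = λ u z c Mu → cl u z c Mu (u ≟ w) }
  where
  cl : ∀ u z → col C u z ≡ just i ⊎ col C u z ≡ just j → M u ≡ true → Dec (u ≡ w) → M z ≡ true
  cl u z (inj₁ c) Mu (yes refl) = subst (λ z → M z ≡ true) (col-proper C cw c) Mw'
  cl u z (inj₂ c) Mu (yes refl) = entry z c
  cl u z c Mu (no ne) = inside u z Mu ne c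
...   | false = chain-swap (grow C j i a fuel M' w' h' (old Ma) new inside' entry' both' hasi)
  where
  M' : Fin n → Bool
  M' z = ⌊ z ≟ w' ⌋ ∨ M z
  old : ∀ {z} → M z ≡ true → M' z ≡ true
  old = ∨-trueʳ
  new : M' w' ≡ true
  new = ∨-trueˡ (⇒true {d = w' ≟ w'} refl)
  split : ∀ {z} → M' z ≡ true → z ≢ w' → M z ≡ true
  split {z} p q with z ≟ w'
  ... | yes r = ⊥-elim (q r)
  ... | no _  = p
  h' : n < count M' + fuel
  h' = ≤-trans h (≤-trans (≤-reflexive (+-suc (count M) fuel))
         (+-monoˡ-≤ fuel (subst (suc (count M) ≤_) (sym (count-remove w' M' new))
           (s≤s (count-mono M (remove M' w') (λ z Mz → remove-intro M' w' {z} (old {z} Mz) (λ { refl → false≢true Mw' Mz })))))))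
  inside' : ∀ u z → M' u ≡ true → u ≢ w' → col C u z ≡ just j ⊎ col C u z ≡ just i → M' z ≡ true
  inside' u z Mu ne c with u ≟ w
  inside' u z Mu ne (inj₁ c) | yes refl = old (entry z c)
  inside' u z Mu ne (inj₂ c) | yes refl = subst (λ z → M' z ≡ true) (col-proper C cw c) new
  ... | no ne' = old (inside u z (split Mu ne) ne' (swap c))
  entry' : ∀ z → col C w' z ≡ just i → M' z ≡ true
  entry' z c = subst (λ z → M' z ≡ true) (col-proper C (trans (col-sym C w' w) cw) c) (old Mw)
  both' : ∀ u → M' u ≡ true → u ≢ a → u ≢ w' → Has C u j × Has C u i
  both' u Mu ua uw' with u ≟ w
  ... | yes refl = hasj ua , (w' , cw)
  ... | no ne = let (x , y) = both u (split Mu uw') ua ne in y , x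
  hasi : w' ≢ a → Has C w' i
  hasi _ = w , trans (col-sym C w' w) cw

chain : (C : PartialColouring n K) (i j : Fin K) (a : Fin n) → ¬ Has C a j → Chain C i j a
chain {n} C i j a miss = grow C i j a (suc n) (λ z → ⌊ z ≟ a ⌋) a
  (subst (n <_) (sym (+-suc _ n)) (s≤s (m≤n+m n _)))
  (⇒true {d = a ≟ a} refl) (⇒true {d = a ≟ a} refl)
  (λ u z p q _ → ⊥-elim (q (true⇒ {d = u ≟ a} p)))
  (λ z c → ⊥-elim (miss (z , c)))
  (λ u p q _ → ⊥-elim (q (true⇒ {d = u ≟ a} p)))
  (λ q → ⊥-elim (q refl))

module _ (C : PartialColouring n K) (i j : Fin K) {a : Fin n} (ch : Chain C i j a) where
  open Chain ch

  relabel : Fin n → Fin K → Fin K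
  relabel u x = if mem u then transpose i j x else x

  relabel-involutive : ∀ u x → relabel u (relabel u x) ≡ x
  relabel-involutive u x with mem u
  ... | true  = transpose-involutive i j x
  ... | false = refl

  mem-agree : ∀ u w → col C u w ≡ just i ⊎ col C u w ≡ just j → mem u ≡ mem w
  mem-agree u w c = bool-ext (closed u w c) (closed w u (helper c))
    where
    helper : col C u w ≡ just i ⊎ col C u w ≡ just j → col C w u ≡ just i ⊎ col C w u ≡ just j
    helper (inj₁ c) = inj₁ (trans (col-sym C w u) c)
    helper (inj₂ c) = inj₂ (trans (col-sym C w u) c)

  relabel-≢ : ∀ u {x} → x ≢ i → x ≢ j → relabel u x ≡ x
  relabel-≢ u p q with mem u
  ... | true  = transpose-≢ p q
  ... | false = refl

  -- Makes `kempe-col` symmetric although it relabels by the first endpoint: an edge coloured `i` or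
  -- `j` has both ends in the chain or neither, and every other colour is fixed.
  relabel-agree : ∀ u w x → col C u w ≡ just x → relabel u x ≡ relabel w x
  relabel-agree u w x c = helper (x ≟ i) (x ≟ j)
    where
    helper : Dec (x ≡ i) → Dec (x ≡ j) → relabel u x ≡ relabel w x
    helper (yes refl) _ rewrite mem-agree u w (inj₁ c) = refl
    helper (no _) (yes refl) rewrite mem-agree u w (inj₂ c) = refl
    helper (no p) (no q) = trans (relabel-≢ u p q) (sym (relabel-≢ w p q))

  kempe-col : ∀ u w → Maybe (Fin K)
  kempe-col u w = map (relabel u) (col C u w)

  kempe-col⁻ : ∀ u w {x} → kempe-col u w ≡ just x → col C u w ≡ just (relabel u x)
  kempe-col⁻ u w e with col C u w
  kempe-col⁻ u w refl | just y = cong just (sym (relabel-involutive u y))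

  kempe : PartialColouring n K
  kempe = record
    { col = kempe-col
    ; col-sym = csym
    ; col-proper = λ {u} {v} {w} p q → col-proper C (kempe-col⁻ u v p) (kempe-col⁻ u w q)
    }
    where
    csym : ∀ u w → kempe-col u w ≡ kempe-col w u
    csym u w rewrite col-sym C w u with col C u w in e
    ... | just x  = cong just (relabel-agree u w x e)
    ... | nothing = refl

  kempe-has⁻ : ∀ {u x} → Has kempe u x → Has C u (relabel u x)
  kempe-has⁻ {u} (w , e) = w , kempe-col⁻ u w e

  kempe-support : ∀ u w → is-just (kempe-col u w) ≡ is-just (col C u w)
  kempe-support u w with col C u w
  ... | just _  = refl
  ... | nothing = refl

-- Candidate colours and their balancing

count-involution : (f : Fin n → Bool) (π : Fin n → Fin n) → (∀ x → π (π x) ≡ x) → count (f ∘ π) ≡ count f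
count-involution f π inv = ≤-antisym
  (count-inject (f ∘ π) f (λ x _ → π x) (λ _ p → p) (λ x y _ _ → inj))
  (count-inject f (f ∘ π) (λ x _ → π x) (λ x p → trans (cong f (inv x)) p) (λ x y _ _ → inj))
  where
  inj : ∀ {x y} → π x ≡ π y → x ≡ y
  inj {x} {y} e = trans (sym (inv x)) (trans (cong π e) (inv y))

-- For u in N the edge uv is still to be coloured, and T u is a set of candidate colours for it.
record Tokens (C : PartialColouring n K) (A : Fin K → Bool) (N : Fin n → Bool) (v : Fin n) : Set where
  field
    T        : Fin n → Fin K → Bool
    T-active : ∀ {u x} → T u x ≡ true → A x ≡ true
    T-nbr    : ∀ {u x} → T u x ≡ true → N u ≡ true
    T-miss   : ∀ {u x} → T u x ≡ true → ¬ Has C u x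
    v-miss   : ∀ {x} → A x ≡ true → ¬ Has C v x

  holders : Fin K → ℕ
  holders x = count (λ u → T u x)

  unheld : Fin K → Bool
  unheld x = A x ∧ ⌊ holders x ℕ.≟ 0 ⌋
open Tokens

module _ {C : PartialColouring n K} {A : Fin K → Bool} {N : Fin n → Bool} {v : Fin n}
         (tk : Tokens C A N v) {i j : Fin K} {a : Fin n} (Ai : A i ≡ true) (Aj : A j ≡ true)
         (ch : Chain C i j a) where

  -- Candidates are relabelled along with the edges at each vertex. Since `i` and `j` are both
  -- active, this permutes the active colours, so `v` still misses all of them.
  kempe-tokens : Tokens (kempe C i j ch) A N v
  kempe-tokens = record
    { T = λ u x → T tk u (relabel C i j ch u x)
    ; T-active = λ {u} {x} p → subst (λ x → A x ≡ true) (relabel-involutive C i j ch u x)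
                                 (relabel-active u _ (T-active tk p))
    ; T-nbr = T-nbr tk
    ; T-miss = λ p h → T-miss tk p (kempe-has⁻ C i j ch h)
    ; v-miss = λ {x} p h → v-miss tk (relabel-active v x p) (kempe-has⁻ C i j ch h)
    }
    where
    relabel-active : ∀ u x → A x ≡ true → A (relabel C i j ch u x) ≡ true
    relabel-active u x p = helper (x ≟ i) (x ≟ j)
      where
      helper : Dec (x ≡ i) → Dec (x ≡ j) → A (relabel C i j ch u x) ≡ true
      helper (no p') (no q) rewrite relabel-≢ C i j ch u p' q = p
      helper (yes refl) _ with Chain.mem ch u
      ... | true  rewrite transposeˡ i j = Aj
      ... | false = Ai
      helper _ (yes refl) with Chain.mem ch u
      ... | true  rewrite transposeʳ i j = Ai
      ... | false = Aj

  -- The exchange hands `i` to `a`, so `i` stops being unheld. Colour `j` does not become unheld: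
  -- one of its three holders is neither `a` nor `end`, and it lies outside the chain because inner
  -- members see `j` while a holder misses it. Other colours keep their holders.
  kempe-unheld : holders tk i ≡ 0 → T tk a j ≡ true → 3 ≤ holders tk j →
                 count (unheld kempe-tokens) < count (unheld tk)
  kempe-unheld i0 Taj j3 = subst (count (unheld kempe-tokens) <_)
      (sym (count-remove i (unheld tk) (∧-true Ai (⇒true {d = holders tk i ℕ.≟ 0} i0))))
      (s≤s (count-mono (unheld kempe-tokens) (remove (unheld tk) i)
        (λ x p → remove-intro (unheld tk) i (∧-true (∧-trueˡ p) (sub x p)) (λ { refl → not-i p }))))
    where
    open Chain ch
    T' = T kempe-tokens
    pos : ∀ {x u} → T' u x ≡ true → unheld kempe-tokens x ≡ true → ⊥
    pos {x} {u} t p = <⇒≢ (0<count {f = λ u → T' u x} u t)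
                        (sym (true⇒ {d = holders kempe-tokens x ℕ.≟ 0} (∧-trueʳ {A x} p)))
    not-i : unheld kempe-tokens i ≡ true → ⊥
    not-i = pos {i} {a} helper
      where
      helper : T' a i ≡ true
      helper rewrite start | transposeˡ i j = Taj
    not-j : unheld kempe-tokens j ≡ true → ⊥
    not-j p = pos {j} {proj₁ other} T'uj p
      where
      Tj = λ u → T tk u j
      third : 0 < count (remove (remove Tj a) end)
      third = ≤-pred (≤-pred (≤-trans j3 (≤-trans (count-remove-≤ a Tj) (s≤s (count-remove-≤ end (remove Tj a))))))
      other : ∃ λ u → remove (remove Tj a) end u ≡ true
      other = ∃-of-count _ third
      T'uj : T' (proj₁ other) j ≡ true
      T'uj with other
      ... | u , q with remove-⊆ (remove Tj a) end q
      ...   | r with mem u in e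
      ...     | false = remove-⊆ Tj a r
      ...     | true  = ⊥-elim (T-miss tk (remove-⊆ Tj a r)
                          (proj₂ (inner u e (remove-≢ Tj a r) (remove-≢ (remove Tj a) end q))))
    sub : ∀ x → unheld kempe-tokens x ≡ true → ⌊ holders tk x ℕ.≟ 0 ⌋ ≡ true
    sub x p = helper (x ≟ i) (x ≟ j)
      where
      helper : Dec (x ≡ i) → Dec (x ≡ j) → ⌊ holders tk x ℕ.≟ 0 ⌋ ≡ true
      helper (yes refl) _ = ⊥-elim (not-i p)
      helper _ (yes refl) = ⊥-elim (not-j p)
      helper (no q) (no r) = ⇒true {d = holders tk x ℕ.≟ 0} (trans
        (count-cong (λ u → cong (T tk u) (sym (relabel-≢ C i j ch u q r))))
        (true⇒ {d = holders kempe-tokens x ℕ.≟ 0} (∧-trueʳ {A x} p)))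

Rebalanced : ∀ {C : PartialColouring n K} {A N v} → Tokens C A N v → Set
Rebalanced {n} {K} {C} {A} {N} {v} tk =
  Σ (PartialColouring n K) λ C' → Σ (Tokens C' A N v) λ tk' →
    (∀ u w → is-just (col C' u w) ≡ is-just (col C u w)) ×
    (∀ u → count (T tk' u) ≡ count (T tk u)) ×
    (∃ λ i → holders tk' i ≡ 1)

-- On average a colour has fewer than two holders, so some active colour has none (unless one has
-- exactly one); as the total is odd, some colour has at least three, and a Kempe change helps.
rebalance : ∀ z {C : PartialColouring n K} {A N v} (tk : Tokens C A N v) → count (unheld tk) ≤ z →
            odd (sum (λ u → count (T tk u))) ≡ true → sum (λ u → count (T tk u)) < count A * 2 →
            Rebalanced tk
rebalance {n} {K} z {C} {A} {N} {v} tk hz hodd hsum with any? (λ i → holders tk i ℕ.≟ 1)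
... | yes one = C , tk , (λ _ _ → refl) , (λ _ → refl) , one
... | no none = step z hz (sum-<⇒∃< (holders tk) (λ x → if A x then 2 else 0)
                        (subst₂ _<_ swap-sum (sym (sum-if A 2)) hsum))
                      (odd-sum (holders tk) (trans (cong odd (sym swap-sum)) hodd))
  where
  swap-sum : sum (λ u → count (T tk u)) ≡ sum (holders tk)
  swap-sum = ∑count-comm (T tk)
  small : ∀ i → holders tk i < (if A i then 2 else 0) → A i ≡ true × holders tk i ≡ 0
  small i h with A i | holders tk i in e
  ... | true | zero  = refl , refl
  ... | true | suc zero = ⊥-elim (none (i , e))
  small i (s≤s (s≤s ())) | true | suc (suc _)
  large : ∀ j → odd (holders tk j) ≡ true → 3 ≤ holders tk j
  large j h with holders tk j in e
  large j () | 0
  ... | 1 = ⊥-elim (none (j , e))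
  large j () | 2
  ... | suc (suc (suc _)) = s≤s (s≤s (s≤s z≤n))
  step : ∀ z → count (unheld tk) ≤ z → (∃ λ i → holders tk i < (if A i then 2 else 0)) →
         (∃ λ j → odd (holders tk j) ≡ true) → Rebalanced tk
  step z hz (i , hi) (j , hj) with small i hi | large j hj
  ... | Ai , i0 | j3 with ∃-of-count (λ u → T tk u j) (≤-trans (s≤s z≤n) j3)
  ...   | a , Taj = continue z (<-≤-trans (kempe-unheld tk Ai Aj ch i0 Taj j3) hz)
    where
    Aj = T-active tk Taj
    ch = chain C i j a (T-miss tk Taj)
    tk' = kempe-tokens tk Ai Aj ch
    sizes : ∀ u → count (T tk' u) ≡ count (T tk u)
    sizes u = count-involution (T tk u) (relabel C i j ch u) (relabel-involutive C i j ch u)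
    sum≡ : sum (λ u → count (T tk' u)) ≡ sum (λ u → count (T tk u))
    sum≡ = sum-cong-≗ sizes
    continue : ∀ z → count (unheld tk') < z → Rebalanced tk
    continue (suc z) h with rebalance z tk' (≤-pred h) (trans (cong odd sum≡) hodd)
                              (subst (_< count A * 2) (sym sum≡) hsum)
    ... | C'' , tk'' , supp , cnt , one =
      C'' , tk'' , (λ u w → trans (supp u w) (kempe-support C i j ch u w))
          , (λ u → trans (cnt u) (sizes u)) , one

-- Colouring the edges at one vertex, and Vizing's theorem by induction

module _ (C : PartialColouring n K) (i : Fin K) {u v : Fin n} (mu : ¬ Has C u i) (mv : ¬ Has C v i) where

  private
    new? : (a b : Fin n) → Dec ((a ≡ u × b ≡ v) ⊎ (a ≡ v × b ≡ u))
    new? a b = (a ≟ u ×-dec b ≟ v) ⊎-dec (a ≟ v ×-dec b ≟ u)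

    flip-new : ∀ {a b} → (a ≡ u × b ≡ v) ⊎ (a ≡ v × b ≡ u) → (b ≡ u × a ≡ v) ⊎ (b ≡ v × a ≡ u)
    flip-new (inj₁ (p , q)) = inj₂ (q , p)
    flip-new (inj₂ (p , q)) = inj₁ (q , p)

    ins : Fin n → Fin n → Maybe (Fin K)
    ins a b = if ⌊ new? a b ⌋ then just i else col C a b

    ins-sym : ∀ a b → ins a b ≡ ins b a
    ins-sym a b = cong₂ (λ t c → if t then just i else c)
      (bool-ext (λ p → ⇒true {d = new? b a} (flip-new (true⇒ {d = new? a b} p)))
                (λ p → ⇒true {d = new? a b} (flip-new (true⇒ {d = new? b a} p))))
      (col-sym C a b)

    ins⁻ : ∀ {a b x} → ins a b ≡ just x → (((a ≡ u × b ≡ v) ⊎ (a ≡ v × b ≡ u)) × x ≡ i) ⊎ col C a b ≡ just x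
    ins⁻ {a} {b} e with new? a b
    ins⁻ refl | yes p = inj₁ (p , refl)
    ... | no _ = inj₂ e

    misses : ∀ {a b} → (a ≡ u × b ≡ v) ⊎ (a ≡ v × b ≡ u) → ¬ Has C a i
    misses (inj₁ (refl , _)) = mu
    misses (inj₂ (refl , _)) = mv

    same-end : ∀ {a b c} → (a ≡ u × b ≡ v) ⊎ (a ≡ v × b ≡ u) → (a ≡ u × c ≡ v) ⊎ (a ≡ v × c ≡ u) → b ≡ c
    same-end (inj₁ (_ , refl)) (inj₁ (_ , refl)) = refl
    same-end (inj₁ (refl , refl)) (inj₂ (refl , refl)) = refl
    same-end (inj₂ (refl , refl)) (inj₁ (refl , refl)) = refl
    same-end (inj₂ (_ , refl)) (inj₂ (_ , refl)) = refl

    ins-proper : ∀ {a b c x} → ins a b ≡ just x → ins a c ≡ just x → b ≡ c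
    ins-proper {a} {b} {c} p q with ins⁻ {a} {b} p | ins⁻ {a} {c} q
    ... | inj₁ (p , _)    | inj₁ (q , _)    = same-end p q
    ... | inj₁ (p , refl) | inj₂ q          = ⊥-elim (misses p (c , q))
    ... | inj₂ p          | inj₁ (q , refl) = ⊥-elim (misses q (b , p))
    ... | inj₂ p          | inj₂ q          = col-proper C p q

  insert : PartialColouring n K
  insert = record { col = ins ; col-sym = ins-sym ; col-proper = ins-proper }

  insert-has⁻ : ∀ {a x} → Has insert a x → x ≡ i ⊎ Has C a x
  insert-has⁻ {a} (b , e) with ins⁻ {a} {b} e
  ... | inj₁ (_ , p) = inj₁ p
  ... | inj₂ p       = inj₂ (b , p)

  insert-support⁺ : ∀ {a b} → is-just (col C a b) ≡ true ⊎ (a ≡ u × b ≡ v) ⊎ (a ≡ v × b ≡ u) →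
                    is-just (col insert a b) ≡ true
  insert-support⁺ {a} {b} h with new? a b | h
  ... | yes _ | _      = refl
  ... | no _  | inj₁ p = p
  ... | no q  | inj₂ p = ⊥-elim (q p)

  insert-support⁻ : ∀ {a b} → is-just (col insert a b) ≡ true →
                    is-just (col C a b) ≡ true ⊎ (a ≡ u × b ≡ v) ⊎ (a ≡ v × b ≡ u)
  insert-support⁻ {a} {b} h with new? a b
  ... | yes p = inj₂ p
  ... | no _  = inj₁ h

free : PartialColouring n K → (Fin K → Bool) → Fin n → Fin K → Bool
free C A u x = A x ∧ not ⌊ has? C u x ⌋

free-intro : ∀ (C : PartialColouring n K) A {u x} → A x ≡ true → ¬ Has C u x → free C A u x ≡ true
free-intro C A {u} {x} p q = ∧-true p (cong not (⇒false {d = has? C u x} q))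

free-miss : ∀ (C : PartialColouring n K) A {u x} → free C A u x ≡ true → ¬ Has C u x
free-miss C A {u} {x} p q = false≢true (not-true (∧-trueʳ {A x} p)) (⇒true {d = has? C u x} q)

Star : (Fin n → Bool) → Fin n → Fin n → Fin n → Set
Star N v a b = (a ≡ v × N b ≡ true) ⊎ (b ≡ v × N a ≡ true)

record Attached (C : PartialColouring n K) (N : Fin n → Bool) (v : Fin n) : Set where
  field
    result : PartialColouring n K
    to     : ∀ {a b} → is-just (col C a b) ≡ true ⊎ Star N v a b → is-just (col result a b) ≡ true
    from   : ∀ {a b} → is-just (col result a b) ≡ true → is-just (col C a b) ≡ true ⊎ Star N v a b

-- Schrijver's form of Vizing's argument: z is the only vertex of N that may have just one free colour.
-- After rebalancing some colour i is held by a single vertex u; colour uv with i and retire i.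
attach : ∀ p (C : PartialColouring n K) A N v z → count N ≡ p → count N ≤ count A →
         (∀ {x} → A x ≡ true → ¬ Has C v x) →
         (∀ u → N u ≡ true → u ≢ z → 2 ≤ count (free C A u)) →
         (∀ u → N u ≡ true → 1 ≤ count (free C A u)) →
         Attached C N v
attach zero C A N v z hp _ _ _ _ = record { result = C ; to = to' ; from = inj₁ }
  where
  none : ∀ {u} → N u ≡ true → ⊥
  none {u} p = <⇒≢ (0<count u p) (sym hp)
  to' : ∀ {a b} → is-just (col C a b) ≡ true ⊎ Star N v a b → is-just (col C a b) ≡ true
  to' (inj₁ p) = p
  to' (inj₂ (inj₁ (_ , p))) = ⊥-elim (none p)
  to' (inj₂ (inj₂ (_ , p))) = ⊥-elim (none p)
attach {n} {K} (suc p) C A N v z hp hA v-miss two one = main (pick (N z) refl)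
  where
  -- If `z` is outside `N`, all members have two free colours and any of them may serve as the
  -- exceptional vertex.
  pick : ∀ b → N z ≡ b → ∃ λ z' → N z' ≡ true × (∀ u → N u ≡ true → u ≢ z' → 2 ≤ count (free C A u))
  pick true e = z , e , two
  pick false e with ∃-of-count N (subst (0 <_) (sym hp) (s≤s z≤n))
  ... | z' , p = z' , p , (λ u q _ → two u q (λ { refl → false≢true e q }))
  main : (∃ λ z' → N z' ≡ true × (∀ u → N u ≡ true → u ≢ z' → 2 ≤ count (free C A u))) → Attached C N v
  main (z' , Nz' , two') = finish (rebalance (count (unheld tk)) tk ≤-refl sizes-odd sizes-small)
    where
    -- One candidate at `z'` and two at the other members of `N` give a total of 2|N| - 1, which is
    -- odd and below 2|A|: exactly what `rebalance` asks for.
    size : Fin n → ℕ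
    size u = if N u then (if ⌊ u ≟ z' ⌋ then 1 else 2) else 0
    size≤ : ∀ u → size u ≤ count (free C A u)
    size≤ u with N u in e | u ≟ z'
    ... | false | _    = z≤n
    ... | true | yes _ = one u e
    ... | true | no ne = two' u e ne
    pruned : ∀ u → ∃ λ g → (∀ x → g x ≡ true → free C A u x ≡ true) × count g ≡ size u
    pruned u = subset-of-size (free C A u) (size u) (size≤ u)
    size-N : ∀ u → 0 < size u → N u ≡ true
    size-N u h with N u
    ... | true = refl
    size-N u () | false
    tk : Tokens C A N v
    tk = record
      { T = λ u → proj₁ (pruned u)
      ; T-active = λ {u} {x} p → ∧-trueˡ (proj₁ (proj₂ (pruned u)) x p)
      ; T-nbr = λ {u} {x} p → size-N u (subst (0 <_) (proj₂ (proj₂ (pruned u))) (0<count x p))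
      ; T-miss = λ {u} {x} p → free-miss C A (proj₁ (proj₂ (pruned u)) x p)
      ; v-miss = v-miss
      }
    total : sum size + 1 ≡ count N * 2
    total = begin
      sum size + 1
        ≡⟨ cong (sum size +_) (sym (trans (sum-if (λ u → ⌊ u ≟ z' ⌋) 1) (trans (*-identityʳ _) single))) ⟩
      sum size + sum (λ u → if ⌊ u ≟ z' ⌋ then 1 else 0)
        ≡⟨ sym (∑-distrib-+ size _) ⟩
      sum (λ u → size u + (if ⌊ u ≟ z' ⌋ then 1 else 0))
        ≡⟨ sum-cong-≗ pointwise ⟩
      sum (λ u → if N u then 2 else 0)
        ≡⟨ sum-if N 2 ⟩
      count N * 2 ∎
      where
      open ≡-Reasoning
      single : count (λ u → ⌊ u ≟ z' ⌋) ≡ 1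
      single = count≡1 _ z' (⇒true {d = z' ≟ z'} refl) (λ u → true⇒ {d = u ≟ z'})
      pointwise : ∀ u → size u + (if ⌊ u ≟ z' ⌋ then 1 else 0) ≡ (if N u then 2 else 0)
      pointwise u with N u in e | u ≟ z'
      ... | true  | yes _ = refl
      ... | true  | no _  = refl
      ... | false | no _  = refl
      ... | false | yes refl = false≢true e Nz'
    sum≡ : sum (λ u → count (T tk u)) ≡ sum size
    sum≡ = sum-cong-≗ (λ u → proj₂ (proj₂ (pruned u)))
    sizes-odd : odd (sum (λ u → count (T tk u))) ≡ true
    sizes-odd rewrite sum≡ = odd-pred (sum size) (trans (cong odd (trans (+-comm 1 _) total)) (odd-double (count N)))
      where
      odd-double : ∀ k → odd (k * 2) ≡ false
      odd-double zero = refl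
      odd-double (suc k) rewrite odd-double k = refl
      odd-pred : ∀ k → odd (suc k) ≡ false → odd k ≡ true
      odd-pred k e with odd k
      ... | true = refl
    sizes-small : sum (λ u → count (T tk u)) < count A * 2
    sizes-small rewrite sum≡ = ≤-trans (≤-reflexive (trans (+-comm 1 _) total)) (*-monoˡ-≤ 2 hA)
    finish : Rebalanced tk → Attached C N v
    finish (C' , tk' , supp , cnt , i , hi) with ∃-of-count (λ u → T tk' u i) (subst (0 <_) (sym hi) (s≤s z≤n))
    ... | u , Tui = record { result = result ; to = to' ; from = from' }
      where
      N' = remove N u
      A' = remove A i
      Nu = T-nbr tk' Tui
      Ai = T-active tk' Tui
      mu = T-miss tk' Tui
      mv = Tokens.v-miss tk' Ai
      C'' = insert C' i mu mv
      -- Since `u` alone holds `i`, retiring `i` costs no other vertex a candidate, so the bounds 2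
      -- and 1 survive into the recursive call.
      fewer : ∀ w → N' w ≡ true → count (T tk' w) ≤ count (free C'' A' w)
      fewer w p = count-mono (T tk' w) (free C'' A' w) sub
        where
        sub : ∀ x → T tk' w x ≡ true → free C'' A' w x ≡ true
        sub x q = free-intro C'' A' (remove-intro A i (T-active tk' q) x≢i) miss
          where
          x≢i : x ≢ i
          x≢i refl = remove-≢ N u p (count≡1-unique (λ u → T tk' u i) hi q Tui)
          miss : ¬ Has C'' w x
          miss h with insert-has⁻ C' i mu mv h
          ... | inj₁ e = x≢i e
          ... | inj₂ e = T-miss tk' q e
      size' : ∀ w → N w ≡ true → (w ≢ z' → 2 ≤ count (T tk' w)) × 1 ≤ count (T tk' w)
      size' w p rewrite cnt w | proj₂ (proj₂ (pruned w)) | p with w ≟ z'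
      ... | yes e = (λ ne → ⊥-elim (ne e)) , ≤-refl
      ... | no _  = (λ _ → ≤-refl) , s≤s z≤n
      rest : Attached C'' N' v
      rest = attach p C'' A' N' v z'
        (cong (_∸ 1) (trans (sym (count-remove u N Nu)) hp))
        (≤-pred (subst₂ _≤_ (count-remove u N Nu) (count-remove i A Ai) hA))
        v-miss'
        (λ w q ne → ≤-trans (proj₁ (size' w (remove-⊆ N u q)) ne) (fewer w q))
        (λ w q → ≤-trans (proj₂ (size' w (remove-⊆ N u q))) (fewer w q))
        where
        v-miss' : ∀ {x} → A' x ≡ true → ¬ Has C'' v x
        v-miss' q h with insert-has⁻ C' i mu mv h
        ... | inj₁ e = remove-≢ A i q e
        ... | inj₂ e = Tokens.v-miss tk' (remove-⊆ A i q) e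
      open Attached rest
      star : ∀ {a b} → Star N v a b → ((a ≡ u × b ≡ v) ⊎ (a ≡ v × b ≡ u)) ⊎ Star N' v a b
      star {a} {b} (inj₁ (e , q)) = split (b ≟ u)
        where
        split : Dec (b ≡ u) → ((a ≡ u × b ≡ v) ⊎ (a ≡ v × b ≡ u)) ⊎ Star N' v a b
        split (yes r) = inj₁ (inj₂ (e , r))
        split (no r)  = inj₂ (inj₁ (e , remove-intro N u q r))
      star {a} {b} (inj₂ (e , q)) = split (a ≟ u)
        where
        split : Dec (a ≡ u) → ((a ≡ u × b ≡ v) ⊎ (a ≡ v × b ≡ u)) ⊎ Star N' v a b
        split (yes r) = inj₁ (inj₁ (r , e))
        split (no r)  = inj₂ (inj₂ (e , remove-intro N u q r))
      to' : ∀ {a b} → is-just (col C a b) ≡ true ⊎ Star N v a b → is-just (col result a b) ≡ true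
      to' {a} {b} (inj₁ q) = to (inj₁ (insert-support⁺ C' i mu mv (inj₁ (trans (supp a b) q))))
      to' (inj₂ s) with star s
      ... | inj₁ q = to (inj₁ (insert-support⁺ C' i mu mv (inj₂ q)))
      ... | inj₂ q = to (inj₂ q)
      from' : ∀ {a b} → is-just (col result a b) ≡ true → is-just (col C a b) ≡ true ⊎ Star N v a b
      from' {a} {b} q with from q
      ... | inj₂ (inj₁ (e , r)) = inj₂ (inj₁ (e , remove-⊆ N u r))
      ... | inj₂ (inj₂ (e , r)) = inj₂ (inj₂ (e , remove-⊆ N u r))
      ... | inj₁ r with insert-support⁻ C' i mu mv r
      ...   | inj₁ s = inj₁ (trans (sym (supp a b)) s)
      ...   | inj₂ (inj₁ (refl , refl)) = inj₂ (inj₂ (refl , Nu))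
      ...   | inj₂ (inj₂ (refl , refl)) = inj₂ (inj₁ (refl , Nu))

add-isolated : PartialColouring n K → PartialColouring (suc n) K
add-isolated {n} {K} C = record { col = c ; col-sym = csym ; col-proper = λ {u} {v} {w} → cproper u v w }
  where
  c : Fin (suc n) → Fin (suc n) → Maybe (Fin K)
  c zero    _       = nothing
  c (suc _) zero    = nothing
  c (suc u) (suc v) = col C u v
  csym : ∀ u v → c u v ≡ c v u
  csym zero zero = refl
  csym zero (suc v) = refl
  csym (suc u) zero = refl
  csym (suc u) (suc v) = col-sym C u v
  cproper : ∀ u v w {i} → c u v ≡ just i → c u w ≡ just i → v ≡ w
  cproper (suc u) (suc v) (suc w) p q = cong suc (col-proper C p q)

-- Induction on the vertices. With vertex `zero` taken out, each of its neighbours has at most D - 1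
-- coloured edges and so at least two free colours among D + 1, which lets `attach` colour all edges
-- at `zero`.
partial-vizing : ∀ {n} D (E : Fin n → Fin n → Bool) → (∀ u v → E u v ≡ E v u) → (∀ u → E u u ≡ false) →
                 (∀ u → count (E u) ≤ D) →
                 Σ (PartialColouring n (suc D)) λ C → ∀ u v → is-just (col C u v) ≡ E u v
partial-vizing {zero} D E _ _ _ = record { col = λ () ; col-sym = λ () ; col-proper = λ {} } , (λ ())
partial-vizing {suc n} D E E-sym E-irr deg
  with partial-vizing D (λ u v → E (suc u) (suc v)) (λ u v → E-sym (suc u) (suc v)) (λ u → E-irr (suc u))
         (λ u → ≤-trans (m≤n+m _ (if E (suc u) zero then 1 else 0)) (deg (suc u)))
... | C , supp = result , (λ u v → bool-ext (λ p → from⇒ u v (from p)) (λ p → to (⇒to u v p)))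
  where
  C₀ = add-isolated C
  A : Fin (suc D) → Bool
  A _ = true
  N = E zero
  two : ∀ u → N u ≡ true → 2 ≤ count (free C₀ A u)
  two zero p = false≢true (E-irr zero) p
  two (suc u) p = +-cancelʳ-≤ (count used) 2 _ (≤-trans (s≤s used≤) (≤-reflexive (trans
      (sym (count-all {f = A} (λ _ → refl)))
      (trans (count-split A used) (+-comm (count used) (count (free C₀ A (suc u))))))))
    where
    used : Fin (suc D) → Bool
    used x = ⌊ has? C₀ (suc u) x ⌋
    nbr : ∀ x → used x ≡ true → Fin n
    nbr x q with true⇒ {d = has? C₀ (suc u) x} q
    ... | suc w , _ = w
    nbr-col : ∀ x q → col C u (nbr x q) ≡ just x
    nbr-col x q with true⇒ {d = has? C₀ (suc u) x} q
    ... | suc w , e = e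
    used≤ : suc (count used) ≤ D
    used≤ = ≤-trans (s≤s (count-inject used (λ w → E (suc u) (suc w)) nbr
        (λ x q → trans (sym (supp u (nbr x q))) (cong is-just (nbr-col x q)))
        (λ x y q r e → just-injective (trans (sym (nbr-col x q)) (trans (cong (col C u) e) (nbr-col y r))))))
      (subst (λ b → (if b then 1 else 0) + count (λ w → E (suc u) (suc w)) ≤ D)
        (trans (E-sym (suc u) zero) p) (deg (suc u)))
  -- The second `zero` is the exceptional vertex of `attach`; it is not its own neighbour, so there
  -- is no exception at the start.
  open Attached (attach (count N) C₀ A N zero zero refl
    (≤-trans (deg zero) (≤-trans (n≤1+n D) (≤-reflexive (sym (count-all {f = A} (λ _ → refl))))))
    (λ _ → λ ()) (λ u p _ → two u p) (λ u p → ≤-trans (s≤s z≤n) (two u p)))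
  ⇒to : ∀ u v → E u v ≡ true → is-just (col C₀ u v) ≡ true ⊎ Star N zero u v
  ⇒to zero v p = inj₂ (inj₁ (refl , p))
  ⇒to (suc u) zero p = inj₂ (inj₂ (refl , trans (E-sym zero (suc u)) p))
  ⇒to (suc u) (suc v) p = inj₁ (trans (supp u v) p)
  from⇒ : ∀ u v → is-just (col C₀ u v) ≡ true ⊎ Star N zero u v → E u v ≡ true
  from⇒ (suc u) (suc v) (inj₁ p) = trans (sym (supp u v)) p
  from⇒ u v (inj₂ (inj₁ (refl , p))) = p
  from⇒ u v (inj₂ (inj₂ (refl , p))) = trans (E-sym u zero) p

vizing : (G : SimpleGraph n) (D : ℕ) → (∀ u → degree G u ≤ D) →
         ∃ λ (c : Fin n → Fin n → Fin (suc D)) → IsEdgeColouring G c × IsProper G c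
vizing G D deg with partial-vizing D (adj G) (SimpleGraph.sym G) (irrefl G) deg
-- The default colour reaches non-edges only, where values are irrelevant.
... | C , supp = (λ u v → fromMaybe zero (col C u v)) , (λ u v _ → cong (fromMaybe zero) (col-sym C u v)) , proper
  where
  coloured : ∀ {u v} → Edge G u v → col C u v ≡ just (fromMaybe zero (col C u v))
  coloured {u} {v} e with col C u v | supp u v
  ... | just _  | _ = refl
  ... | nothing | s = false≢true (sym s) e
  proper : IsProper G (λ u v → fromMaybe zero (col C u v))
  proper u v w e f ne h = ne (col-proper C (coloured e) (trans (coloured f) (cong just (sym h))))

-- Sparse subgraphs of controlled degree

count-by-block : (f : Fin n → Bool) (β : Fin n → Fin 3) →
  count f ≡ count (λ i → f i ∧ ⌊ β i ≟ 0F ⌋) + (count (λ i → f i ∧ ⌊ β i ≟ 1F ⌋) + count (λ i → f i ∧ ⌊ β i ≟ 2F ⌋))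
count-by-block f β = trans (count-split f (λ i → ⌊ β i ≟ 0F ⌋)) (cong (count (λ i → f i ∧ ⌊ β i ≟ 0F ⌋) +_)
  (trans (count-split (λ i → f i ∧ not ⌊ β i ≟ 0F ⌋) (λ i → ⌊ β i ≟ 1F ⌋)) (cong₂ _+_ (count-cong one) (count-cong two))))
  where
  one : ∀ i → (f i ∧ not ⌊ β i ≟ 0F ⌋) ∧ ⌊ β i ≟ 1F ⌋ ≡ f i ∧ ⌊ β i ≟ 1F ⌋
  one i with f i | β i
  ... | false | _ = refl
  ... | true | zero = refl
  ... | true | suc zero = refl
  ... | true | suc (suc zero) = refl
  two : ∀ i → (f i ∧ not ⌊ β i ≟ 0F ⌋) ∧ not ⌊ β i ≟ 1F ⌋ ≡ f i ∧ ⌊ β i ≟ 2F ⌋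
  two i with f i | β i
  ... | false | _ = refl
  ... | true | zero = refl
  ... | true | suc zero = refl
  ... | true | suc (suc zero) = refl

-- The two exact blocks provide the lower bound on degrees in `F`; the third takes the remainder and
-- matters for the upper bound.
record Blocks (f : Fin n → Bool) (m : ℕ) : Set where
  field
    block  : Fin n → Fin 3
    first  : count (λ i → f i ∧ ⌊ block i ≟ 0F ⌋) ≡ m
    second : count (λ i → f i ∧ ⌊ block i ≟ 1F ⌋) ≡ m
    third  : count (λ i → f i ∧ ⌊ block i ≟ 2F ⌋) ≤ m

  each : ∀ b → count (λ i → f i ∧ ⌊ block i ≟ b ⌋) ≤ m
  each zero = ≤-reflexive first
  each (suc zero) = ≤-reflexive second
  each (suc (suc zero)) = third

three-blocks : (f : Fin n → Bool) (m : ℕ) → 2 * m ≤ count f → count f ≤ 3 * m → Blocks f m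
three-blocks f m lo hi with subset-of-size f m (≤-trans (m≤m+n m _) lo)
... | g , g⊆f , #g with subset-of-size (λ i → f i ∧ not (g i)) m rest≥
  where
  f∧g : count (λ i → f i ∧ g i) ≡ m
  f∧g = trans (count-cong (λ i → bool-ext ∧-trueʳ (λ p → ∧-true (g⊆f i p) p))) #g
  rest≥ : m ≤ count (λ i → f i ∧ not (g i))
  rest≥ = +-cancelˡ-≤ m _ _ (subst₂ _≤_ (cong (m +_) (+-identityʳ m))
            (trans (count-split f g) (cong (_+ count (λ i → f i ∧ not (g i))) f∧g)) lo)
...   | h , h⊆ , #h = record { block = β ; first = e₀ ; second = e₁
                             ; third = +-cancelˡ-≤ m _ _ (+-cancelˡ-≤ m _ _ (subst₂ _≤_
                                (trans (count-by-block f β) (cong₂ (λ a b → a + (b + count (λ i → f i ∧ ⌊ β i ≟ 2F ⌋))) e₀ e₁))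
                                (cong (λ a → m + (m + a)) (+-identityʳ m)) hi)) }
  where
  β : _ → Fin 3
  β i = if g i then 0F else (if h i then 1F else 2F)
  e₀ : count (λ i → f i ∧ ⌊ β i ≟ 0F ⌋) ≡ m
  e₀ = trans (count-cong helper) #g
    where
    helper : ∀ i → f i ∧ ⌊ β i ≟ 0F ⌋ ≡ g i
    helper i with g i in e
    ... | true rewrite g⊆f i e = refl
    ... | false with f i | h i
    ...   | true  | true  = refl
    ...   | true  | false = refl
    ...   | false | _     = refl
  e₁ : count (λ i → f i ∧ ⌊ β i ≟ 1F ⌋) ≡ m
  e₁ = trans (count-cong helper) #h
    where
    helper : ∀ i → f i ∧ ⌊ β i ≟ 1F ⌋ ≡ h i
    helper i with h i in e
    helper i | true with g i | f i | h⊆ i e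
    ... | false | true | _ = refl
    helper i | false with f i | g i
    ... | false | _     = refl
    ... | true  | true  = refl
    ... | true  | false = refl

-- Splitting every vertex into two vertices of degree m and one of degree at most m, each of the first two
-- sees all but one of the m + 1 colours; keep t + 1 of the colours.
sparse-from-blocks : (G : SimpleGraph n) (m t : ℕ) → t ≤ m → (∀ u → Blocks (adj G u) m) →
                     ∃ λ (F : SimpleGraph n) → (∀ {u v} → Edge F u v → Edge G u v) ×
                     (∀ u → 2 * t ≤ degree F u) × (∀ u → degree F u ≤ 3 * suc t)
sparse-from-blocks {n} G m t t≤m blocks = F , ∧-trueˡ , F-lo , F-hi
  where
  β : Fin n → Fin n → Fin 3
  β u = Blocks.block (blocks u)
  E : Fin n × Fin 3 → Fin n × Fin 3 → Bool
  -- Each edge of G lifts to exactly one edge, joining the copy of `u` whose block contains `v` to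
  -- the copy of `v` whose block contains `u`.
  E (u , b) (v , b') = adj G u v ∧ (⌊ β u v ≟ b ⌋ ∧ ⌊ β v u ≟ b' ⌋)
  E-sym : ∀ p q → E p q ≡ E q p
  E-sym (u , b) (v , b') = cong₂ _∧_ (SimpleGraph.sym G u v) (∧-comm ⌊ β u v ≟ b ⌋ ⌊ β v u ≟ b' ⌋)
  split : Fin (n * 3) → Fin n × Fin 3
  split = remQuot 3
  split-injective : ∀ p q → split p ≡ split q → p ≡ q
  split-injective p q e = trans (sym (combine-remQuot {n} 3 p))
    (trans (cong (λ (u , b) → combine u b) e) (combine-remQuot {n} 3 q))
  H : SimpleGraph (n * 3)
  H = record
    { adj = λ p q → E (split p) (split q)
    ; sym = λ p q → E-sym (split p) (split q)
    ; irrefl = λ p → cong (_∧ (⌊ β (proj₁ (split p)) (proj₁ (split p)) ≟ proj₂ (split p) ⌋ ∧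
                                ⌊ β (proj₁ (split p)) (proj₁ (split p)) ≟ proj₂ (split p) ⌋))
                         (irrefl G (proj₁ (split p)))
    }
  H-deg : ∀ p → degree H p ≤ m
  H-deg p = ≤-trans (count-inject (adj H p) (λ v → adj G u v ∧ ⌊ β u v ≟ b ⌋)
      (λ q _ → proj₁ (split q))
      (λ q e → ∧-true {adj G u (proj₁ (split q))} (∧-trueˡ e)
                 (∧-trueˡ {⌊ β u (proj₁ (split q)) ≟ b ⌋} (∧-trueʳ {adj G u (proj₁ (split q))} e)))
      (λ q r e e' s → split-injective q r (cong₂ _,_ s
        (trans (sym (target q e)) (trans (cong (λ v → β v u) s) (target r e'))))))
    (Blocks.each (blocks u) b)
    where
    u = proj₁ (split p)
    b = proj₂ (split p)
    target : ∀ q → adj H p q ≡ true → β (proj₁ (split q)) u ≡ proj₂ (split q)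
    target q e = true⇒ {d = β (proj₁ (split q)) u ≟ proj₂ (split q)}
      (∧-trueʳ {⌊ β u (proj₁ (split q)) ≟ b ⌋} (∧-trueʳ {adj G u (proj₁ (split q))} e))
  H-colouring = vizing H m H-deg
  y = proj₁ H-colouring
  node : Fin n → Fin n → Fin (n * 3)
  node u v = combine u (β u v)
  Y : Fin n → Fin n → Fin (suc m)
  Y u v = y (node u v) (node v u)
  H-edge : ∀ {u v} → Edge G u v → Edge H (node u v) (node v u)
  H-edge {u} {v} e = subst₂ (λ p q → E p q ≡ true)
    (sym (remQuot-combine u (β u v))) (sym (remQuot-combine v (β v u)))
    (∧-true e (∧-true (⇒true {d = β u v ≟ β u v} refl) (⇒true {d = β v u ≟ β v u} refl)))
  Y-sym : ∀ {u v} → Edge G u v → Y u v ≡ Y v u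
  Y-sym {u} {v} e = proj₁ (proj₂ H-colouring) (node u v) (node v u) (H-edge e)
  Y-proper : ∀ {u v w} → Edge G u v → Edge G u w → β u v ≡ β u w → Y u v ≡ Y u w → v ≡ w
  Y-proper {u} {v} {w} e f s h with v ≟ w
  ... | yes r = r
  ... | no ne = ⊥-elim (proj₂ (proj₂ H-colouring) (node u v) (node v u) (node w u) (H-edge e)
      (subst (λ b → Edge H (combine u b) (node w u)) (sym s) (H-edge f))
      (λ r → ne (combine-injectiveˡ v (β v u) w (β w u) r))
      (trans h (cong (λ b → y (combine u b) (node w u)) (sym s))))
  low : Fin n → Fin n → Bool
  low u v = ⌊ toℕ (Y u v) <? suc t ⌋
  F : SimpleGraph n
  F = record
    { adj = λ u v → adj G u v ∧ low u v
    ; sym = λ u v → bool-ext (flip u v) (flip v u)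
    ; irrefl = λ u → cong (_∧ low u u) (irrefl G u)
    }
    where
    flip : ∀ u v → adj G u v ∧ low u v ≡ true → adj G v u ∧ low v u ≡ true
    flip u v p = ∧-true (trans (SimpleGraph.sym G v u) e) (subst (λ c → ⌊ toℕ c <? suc t ⌋ ≡ true) (Y-sym e) (∧-trueʳ {adj G u v} p))
      where e = ∧-trueˡ p
  part : Fin n → Fin 3 → Fin n → Bool
  part u b v = adj G u v ∧ ⌊ β u v ≟ b ⌋
  F-part : Fin n → Fin 3 → ℕ
  F-part u b = count (λ v → adj F u v ∧ ⌊ β u v ≟ b ⌋)
  F-part≡ : ∀ u b → F-part u b ≡ count (λ v → part u b v ∧ low u v)
  F-part≡ u b = count-cong (λ v → trans (∧-assoc (adj G u v) _ _)
    (trans (cong (adj G u v ∧_) (∧-comm (low u v) _)) (sym (∧-assoc (adj G u v) _ _))))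
  part-injective : ∀ u b {v w} → part u b v ≡ true → part u b w ≡ true → toℕ (Y u v) ≡ toℕ (Y u w) → v ≡ w
  part-injective u b {v} {w} p q e = Y-proper (∧-trueˡ p) (∧-trueˡ q)
    (trans (true⇒ {d = β u v ≟ b} (∧-trueʳ {adj G u v} p)) (sym (true⇒ {d = β u w ≟ b} (∧-trueʳ {adj G u w} q))))
    (toℕ-injective e)
  F-part≤ : ∀ u b → F-part u b ≤ suc t
  F-part≤ u b = subst₂ _≤_ (sym (F-part≡ u b)) (count-all {suc t} {λ _ → true} (λ _ → refl))
    (count-inject _ (λ _ → true) (λ v p → fromℕ< (bound v p)) (λ _ _ → refl)
      (λ v w p q e → part-injective u b (∧-trueˡ p) (∧-trueˡ q)
        (trans (sym (toℕ-fromℕ< (bound v p))) (trans (cong toℕ e) (toℕ-fromℕ< (bound w q))))))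
    where
    bound : ∀ v → part u b v ∧ low u v ≡ true → toℕ (Y u v) < suc t
    bound v p = true⇒ {d = toℕ (Y u v) <? suc t} (∧-trueʳ {part u b v} p)
  -- Among m + 1 colours only m - t are not low, and the m edges of a full block have distinct
  -- colours, so at least t of them are kept.
  F-part≥ : ∀ u b → count (part u b) ≡ m → t ≤ F-part u b
  F-part≥ u b full = +-cancelʳ-≤ (m ∸ t) t _ (subst₂ _≤_ (sym (m+[n∸m]≡n t≤m))
      (cong (_+ (m ∸ t)) (sym (F-part≡ u b)))
      (≤-trans (≤-reflexive (trans (sym full) (count-split (part u b) (low u)))) (+-monoʳ-≤ _ high≤)))
    where
    above : ∀ v → part u b v ∧ not (low u v) ≡ true → suc t ≤ toℕ (Y u v)
    above v p = ≮⇒≥ (λ q → false≢true (not-true (∧-trueʳ {part u b v} p)) (⇒true {d = toℕ (Y u v) <? suc t} q))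
    bound : ∀ v → part u b v ∧ not (low u v) ≡ true → toℕ (Y u v) ∸ suc t < m ∸ t
    bound v p = ∸-monoˡ-< (toℕ<n (Y u v)) (above v p)
    high≤ : count (λ v → part u b v ∧ not (low u v)) ≤ m ∸ t
    high≤ = subst (count (λ v → part u b v ∧ not (low u v)) ≤_) (count-all {m ∸ t} {λ _ → true} (λ _ → refl))
      (count-inject _ (λ _ → true) (λ v p → fromℕ< (bound v p)) (λ _ _ → refl)
        (λ v w p q e → part-injective u b (∧-trueˡ p) (∧-trueˡ q) (∸-cancelʳ-≡ (above v p) (above w q)
          (trans (sym (toℕ-fromℕ< (bound v p))) (trans (cong toℕ e) (toℕ-fromℕ< (bound w q)))))))
  F-lo : ∀ u → 2 * t ≤ degree F u
  F-lo u = ≤-trans (+-mono-≤ (F-part≥ u 0F (Blocks.first (blocks u)))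
      (+-mono-≤ {t} (F-part≥ u 1F (Blocks.second (blocks u))) z≤n))
    (≤-reflexive (sym (count-by-block (adj F u) (β u))))
  F-hi : ∀ u → degree F u ≤ 3 * suc t
  F-hi u = ≤-trans (≤-reflexive (count-by-block (adj F u) (β u)))
    (+-mono-≤ (F-part≤ u 0F) (+-mono-≤ (F-part≤ u 1F)
      (≤-trans (F-part≤ u 2F) (≤-reflexive (sym (+-identityʳ (suc t)))))))

sparse-subgraph : (G : SimpleGraph n) (m t : ℕ) → t ≤ m → (∀ u → 2 * m ≤ degree G u) → (∀ u → degree G u ≤ 3 * m) →
                  ∃ λ (F : SimpleGraph n) → (∀ {u v} → Edge F u v → Edge G u v) ×
                  (∀ u → 2 * t ≤ degree F u) × (∀ u → degree F u ≤ 3 * suc t)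
sparse-subgraph G m t t≤m lo hi = sparse-from-blocks G m t t≤m (λ u → three-blocks (adj G u) m (lo u) (hi u))

-- The local lemma, by counting

every : (Fin n → Bool) → Bool
every {zero}  f = true
every {suc n} f = f zero ∧ every (f ∘ suc)

every⁻ : (f : Fin n → Bool) → every f ≡ true → ∀ i → f i ≡ true
every⁻ f h zero    = ∧-trueˡ h
every⁻ f h (suc i) = every⁻ (f ∘ suc) (∧-trueʳ {f zero} h) i

every⁺ : (f : Fin n → Bool) → (∀ i → f i ≡ true) → every f ≡ true
every⁺ {zero}  f h = refl
every⁺ {suc n} f h = ∧-true (h zero) (every⁺ (f ∘ suc) (h ∘ suc))

every-cong : {f g : Fin n → Bool} → (∀ i → f i ≡ g i) → every f ≡ every g
every-cong {zero}  h = refl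
every-cong {suc n} h = cong₂ _∧_ (h zero) (every-cong (h ∘ suc))

-- The uniform measure on bit vectors, unnormalised

# : (Vec Bool M → Bool) → ℕ
# {zero}  f = if f [] then 1 else 0
# {suc M} f = # (f ∘ (true ∷_)) + # (f ∘ (false ∷_))

#-cong : {f g : Vec Bool M → Bool} → (∀ ω → f ω ≡ g ω) → # f ≡ # g
#-cong {zero}  h rewrite h [] = refl
#-cong {suc M} h = cong₂ _+_ (#-cong (h ∘ (true ∷_))) (#-cong (h ∘ (false ∷_)))

#-mono : (f g : Vec Bool M → Bool) → (∀ ω → f ω ≡ true → g ω ≡ true) → # f ≤ # g
#-mono {zero} f g h with f [] in e
... | false = z≤n
... | true rewrite h [] e = ≤-refl
#-mono {suc M} f g h = +-mono-≤ (#-mono _ _ (h ∘ (true ∷_))) (#-mono _ _ (h ∘ (false ∷_)))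

#-split : (f g : Vec Bool M → Bool) → # f ≡ # (λ ω → f ω ∧ g ω) + # (λ ω → f ω ∧ not (g ω))
#-split {zero} f g with f [] | g []
... | false | _     = refl
... | true  | true  = refl
... | true  | false = refl
#-split {suc M} f g = trans (cong₂ _+_ (#-split (f ∘ (true ∷_)) (g ∘ (true ∷_))) (#-split (f ∘ (false ∷_)) (g ∘ (false ∷_))))
                            (+-interchange (# (fg ∘ (true ∷_))) (# (f¬g ∘ (true ∷_))) (# (fg ∘ (false ∷_))) (# (f¬g ∘ (false ∷_))))
  where
  fg f¬g : Vec Bool (suc M) → Bool
  fg ω = f ω ∧ g ω
  f¬g ω = f ω ∧ not (g ω)
  +-interchange : ∀ a b c d → (a + b) + (c + d) ≡ (a + c) + (b + d)
  +-interchange = solve-∀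

0<#true : 0 < # {M} (λ _ → true)
0<#true {zero}  = s≤s z≤n
0<#true {suc M} = ≤-trans (0<#true {M}) (m≤m+n _ _)

∃-of-# : (f : Vec Bool M → Bool) → 0 < # f → ∃ λ ω → f ω ≡ true
∃-of-# {zero} f h with f [] in e
... | true = [] , e
∃-of-# {suc M} f h with 0 <? # (f ∘ (true ∷_))
... | yes p = let (ω , q) = ∃-of-# _ p in (true ∷ ω) , q
... | no ¬p = let (ω , q) = ∃-of-# (f ∘ (false ∷_)) (subst (λ a → 0 < a + # (f ∘ (false ∷_))) (n≤0⇒n≡0 (≮⇒≥ ¬p)) h)
              in (false ∷ ω) , q

flipAt : Fin M → Vec Bool M → Vec Bool M
flipAt e ω = updateAt ω e not

#-flip : (e : Fin M) (f : Vec Bool M → Bool) → # (f ∘ flipAt e) ≡ # f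
#-flip zero    f = +-comm (# (f ∘ (false ∷_))) _
#-flip (suc e) f = cong₂ _+_ (#-flip e (f ∘ (true ∷_))) (#-flip e (f ∘ (false ∷_)))

-- Flipping bit `e` is a measure-preserving bijection that exchanges `D` with its complement inside
-- `P`.
halving : (e : Fin M) (P D : Vec Bool M → Bool) → (∀ ω → P (flipAt e ω) ≡ P ω) →
          (∀ ω → D (flipAt e ω) ≡ not (D ω)) → 2 * # (λ ω → P ω ∧ D ω) ≡ # P
halving e P D hP hD = sym (trans (#-split P D) (cong (# (λ ω → P ω ∧ D ω) +_)
  (trans (#-cong (λ ω → sym (cong₂ _∧_ (hP ω) (hD ω)))) (trans (#-flip e (λ ω → P ω ∧ D ω)) (sym (+-identityʳ _))))))

-- Bit `e k` toggles `D k` and affects neither `Q` nor any other `D l`: given `Q`, the `D k` are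
-- independent fair tosses.
halvings : ∀ r (e : Fin r → Fin M) (D : Fin r → Vec Bool M → Bool) (Q : Vec Bool M → Bool) →
           (∀ k ω → Q (flipAt (e k) ω) ≡ Q ω) →
           (∀ k ω → D k (flipAt (e k) ω) ≡ not (D k ω)) →
           (∀ k l ω → k ≢ l → D k (flipAt (e l) ω) ≡ D k ω) →
           2 ^ r * # (λ ω → Q ω ∧ every (λ k → D k ω)) ≡ # Q
halvings zero e D Q hQ hD hDD = trans (+-identityʳ _) (#-cong (λ ω → ∧-comm (Q ω) true))
halvings (suc r) e D Q hQ hD hDD = begin
  2 * 2 ^ r * # (λ ω → Q ω ∧ (D zero ω ∧ every (λ k → D (suc k) ω)))
    ≡⟨ *-assoc 2 (2 ^ r) _ ⟩
  2 * (2 ^ r * # (λ ω → Q ω ∧ (D zero ω ∧ every (λ k → D (suc k) ω))))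
    ≡⟨ cong (λ a → 2 * (2 ^ r * a)) (#-cong (λ ω → sym (∧-assoc (Q ω) _ _))) ⟩
  2 * (2 ^ r * # (λ ω → (Q ω ∧ D zero ω) ∧ every (λ k → D (suc k) ω)))
    ≡⟨ cong (2 *_) (halvings r (e ∘ suc) (D ∘ suc) (λ ω → Q ω ∧ D zero ω)
         (λ k ω → cong₂ _∧_ (hQ (suc k) ω) (hDD zero (suc k) ω 0≢1+n))
         (hD ∘ suc) (λ k l ω ne → hDD (suc k) (suc l) ω (λ p → ne (suc-injective p)))) ⟩
  2 * # (λ ω → Q ω ∧ D zero ω)
    ≡⟨ halving (e zero) Q (D zero) (hQ zero) (hD zero) ⟩
  # Q ∎
  where open ≡-Reasoning

-- Each `E l` is intersected with `g` because the local lemma bounds it only conditionally on `g`.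
union-bound : (g h : Vec Bool M → Bool) (S : Fin L → Bool) (E : Fin L → Vec Bool M → Bool) →
  (∀ ω → g ω ≡ true → h ω ≡ true ⊎ ∃ λ l → S l ≡ true × E l ω ≡ true) →
  # g ≤ # h + sum (λ l → if S l then # (λ ω → g ω ∧ E l ω) else 0)
union-bound {L = zero} g h S E cover = ≤-trans (#-mono g h sub) (m≤m+n _ 0)
  where
  sub : ∀ ω → g ω ≡ true → h ω ≡ true
  sub ω p with cover ω p
  ... | inj₁ q = q
union-bound {L = suc L} g h S E cover with S zero in e
... | false = union-bound g h (S ∘ suc) (E ∘ suc) cover'
  where
  cover' : ∀ ω → g ω ≡ true → h ω ≡ true ⊎ ∃ λ l → S (suc l) ≡ true × E (suc l) ω ≡ true
  cover' ω p with cover ω p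
  ... | inj₁ q = inj₁ q
  ... | inj₂ (zero , q , _) = false≢true e q
  ... | inj₂ (suc l , q) = inj₂ (l , q)
... | true = begin
  # g                                   ≡⟨ #-split g (E zero) ⟩
  a + # g'                              ≤⟨ +-monoʳ-≤ a (union-bound g' h (S ∘ suc) (E ∘ suc) cover') ⟩
  a + (# h + sum (λ l → if S (suc l) then # (λ ω → g' ω ∧ E (suc l) ω) else 0))
                                        ≤⟨ +-monoʳ-≤ a (+-monoʳ-≤ (# h) (sum-mono term)) ⟩
  a + (# h + s)                         ≡⟨ sym (+-assoc a (# h) s) ⟩
  a + # h + s                           ≡⟨ cong (_+ s) (+-comm a (# h)) ⟩
  # h + a + s                           ≡⟨ +-assoc (# h) a s ⟩
  # h + (a + s)                         ∎
  where
  open ≤-Reasoning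
  g' = λ ω → g ω ∧ not (E zero ω)
  a = # (λ ω → g ω ∧ E zero ω)
  s = sum (λ l → if S (suc l) then # (λ ω → g ω ∧ E (suc l) ω) else 0)
  term : ∀ l → (if S (suc l) then # (λ ω → g' ω ∧ E (suc l) ω) else 0) ≤ (if S (suc l) then # (λ ω → g ω ∧ E (suc l) ω) else 0)
  term l with S (suc l)
  ... | false = z≤n
  ... | true  = #-mono _ _ (λ ω p → ∧-true (∧-trueˡ (∧-trueˡ {g' ω} p)) (∧-trueʳ {g' ω} p))
  cover' : ∀ ω → g' ω ≡ true → h ω ≡ true ⊎ ∃ λ l → S (suc l) ≡ true × E (suc l) ω ≡ true
  cover' ω p with cover ω (∧-trueˡ p)
  ... | inj₁ q = inj₁ q
  ... | inj₂ (zero , _ , q) = false≢true (not-true (∧-trueʳ {g ω} p)) q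
  ... | inj₂ (suc l , q) = inj₂ (l , q)

-- The lopsided local lemma

good : (Fin L → Vec Bool M → Bool) → (Fin L → Bool) → Vec Bool M → Bool
good E S ω = every (λ k → not (S k ∧ E k ω))

*-sum-≤ : ∀ R c (f : Fin n → ℕ) (S : Fin n → Bool) → (∀ l → R * f l ≤ (if S l then c else 0)) →
          R * sum f ≤ count S * c
*-sum-≤ {zero} R c f S h = ≤-reflexive (*-zeroʳ R)
*-sum-≤ {suc n} R c f S h = begin
  R * (f zero + sum (f ∘ suc))          ≡⟨ *-distribˡ-+ R (f zero) _ ⟩
  R * f zero + R * sum (f ∘ suc)        ≤⟨ +-mono-≤ (h zero) (*-sum-≤ R c (f ∘ suc) (S ∘ suc) (h ∘ suc)) ⟩
  (if S zero then c else 0) + count (S ∘ suc) * c ≡⟨ bit (S zero) ⟩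
  count S * c ∎
  where
  open ≤-Reasoning
  bit : ∀ b → (if b then c else 0) + count (S ∘ suc) * c ≡ ((if b then 1 else 0) + count (S ∘ suc)) * c
  bit true  = refl
  bit false = refl

-- In place of independence, `unlikely` says that `E k` has conditional probability at most 1/R once
-- any family of events outside `dep k` is avoided. The relation `dep` may be asymmetric.
module LocalLemma (E : Fin L → Vec Bool M → Bool) (dep : Fin L → Fin L → Bool) (R d : ℕ)
  (4≤R : 4 ≤ R) (4d≤R : 4 * d ≤ R) (degree≤ : ∀ k → count (dep k) ≤ d)
  (unlikely : ∀ k S → (∀ l → S l ≡ true → dep k l ≡ false) → R * # (λ ω → good E S ω ∧ E k ω) ≤ # (good E S))
  where

  good-⊆ : ∀ S S' → (∀ l → S' l ≡ true → S l ≡ true) → ∀ ω → good E S ω ≡ true → good E S' ω ≡ true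
  good-⊆ S S' sub ω h = every⁺ _ (λ l → helper l (every⁻ _ h l))
    where
    helper : ∀ l → not (S l ∧ E l ω) ≡ true → not (S' l ∧ E l ω) ≡ true
    helper l p with S' l in e
    ... | false = refl
    ... | true rewrite sub l e = p

  extend : (S S' T : Fin L → Bool) → (∀ l → S l ≡ true → S' l ≡ true ⊎ T l ≡ true) → ∀ ω → good E S' ω ≡ true →
           good E S ω ≡ true ⊎ ∃ λ l → T l ≡ true × E l ω ≡ true
  extend S S' T cases ω h with any? (λ l → (T l ∧ E l ω) Bool.≟ true)
  ... | yes (l , p) = inj₂ (l , ∧-trueˡ {T l} p , ∧-trueʳ {T l} p)
  ... | no none = inj₁ (every⁺ _ (λ l → cong not (≢true⇒false (λ p → bad l p (cases l (∧-trueˡ {S l} p))))))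
    where
    bad : ∀ l → S l ∧ E l ω ≡ true → S' l ≡ true ⊎ T l ≡ true → ⊥
    bad l p (inj₁ q) = false≢true (not-true (every⁻ _ h l)) (∧-true {S' l} q (∧-trueʳ {S l} p))
    bad l p (inj₂ q) = none (l , ∧-true {T l} q (∧-trueʳ {S l} p))

  near far : Fin L → (Fin L → Bool) → Fin L → Bool
  near k S l = S l ∧ dep k l
  far  k S l = S l ∧ not (dep k l)

  -- Split `S` into the events near `k` and far from it. Given that the far ones are avoided, `E k`
  -- has probability at most 1/R, and the at most d near ones, each of probability at most 2/R,
  -- together at most 1/2. Conditioning on their avoidance as well thus at most doubles 1/R.
  step : ∀ S k → (∀ l → near k S l ≡ true → R * # (λ ω → good E (far k S) ω ∧ E l ω) ≤ 2 * # (good E (far k S))) →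
         R * # (λ ω → good E S ω ∧ E k ω) ≤ 2 * # (good E S)
  step S k ih = ≤-trans (≤-trans (*-monoʳ-≤ R restrict) (unlikely k (far k S) (λ l p → not-true (∧-trueʳ {S l} p)))) far≤
    where
    g₂ = # (good E (far k S))
    g  = # (good E S)
    s  = sum (λ l → if near k S l then # (λ ω → good E (far k S) ω ∧ E l ω) else 0)
    restrict : # (λ ω → good E S ω ∧ E k ω) ≤ # (λ ω → good E (far k S) ω ∧ E k ω)
    restrict = #-mono _ _ (λ ω p → ∧-true {good E (far k S) ω} (good-⊆ S (far k S) (λ l → ∧-trueˡ {S l}) ω (∧-trueˡ {good E S ω} p)) (∧-trueʳ {good E S ω} p))
    cover : g₂ ≤ g + s
    cover = union-bound (good E (far k S)) (good E S) (near k S) E (extend S (far k S) (near k S) cases)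
      where
      cases : ∀ l → S l ≡ true → far k S l ≡ true ⊎ near k S l ≡ true
      cases l p rewrite p with dep k l
      ... | true  = inj₂ refl
      ... | false = inj₁ refl
    s≤ : R * s ≤ d * (2 * g₂)
    s≤ = ≤-trans (*-sum-≤ R (2 * g₂) _ (near k S) term)
                 (*-monoˡ-≤ (2 * g₂) (≤-trans (count-mono (near k S) (dep k) (λ l → ∧-trueʳ {S l})) (degree≤ k)))
      where
      term : ∀ l → R * (if near k S l then # (λ ω → good E (far k S) ω ∧ E l ω) else 0) ≤ (if near k S l then 2 * g₂ else 0)
      term l with near k S l in e
      ... | true  = ih l e
      ... | false = ≤-reflexive (*-zeroʳ R)
    far≤ : g₂ ≤ 2 * g
    far≤ = *-cancelˡ-≤ R {{ℕ.>-nonZero (≤-trans (s≤s z≤n) 4≤R)}} (+-cancelʳ-≤ (R * g₂) _ _ (begin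
      R * g₂ + R * g₂            ≡⟨ ar₁ R g₂ ⟩
      2 * (R * g₂)               ≤⟨ *-monoʳ-≤ 2 (≤-trans (*-monoʳ-≤ R cover) (≤-reflexive (*-distribˡ-+ R g s))) ⟩
      2 * (R * g + R * s)        ≤⟨ *-monoʳ-≤ 2 (+-monoʳ-≤ (R * g) s≤) ⟩
      2 * (R * g + d * (2 * g₂)) ≡⟨ ar₂ R g d g₂ ⟩
      R * (2 * g) + 4 * d * g₂   ≤⟨ +-monoʳ-≤ (R * (2 * g)) (*-monoˡ-≤ g₂ 4d≤R) ⟩
      R * (2 * g) + R * g₂       ∎))
      where
      open ≤-Reasoning
      ar₁ : ∀ R g₂ → R * g₂ + R * g₂ ≡ 2 * (R * g₂)
      ar₁ = solve-∀
      ar₂ : ∀ R g d g₂ → 2 * (R * g + d * (2 * g₂)) ≡ R * (2 * g) + 4 * d * g₂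
      ar₂ = solve-∀

  conditional : ∀ p S → count S ≤ p → ∀ k → R * # (λ ω → good E S ω ∧ E k ω) ≤ 2 * # (good E S)
  conditional zero S h k = step S k (λ l q → ⊥-elim (<⇒≱ (0<count {f = S} l (∧-trueˡ {S l} q)) h))
  -- The induction hypothesis is used only when some near event exists, and then the far family is
  -- strictly smaller than `S`.
  conditional (suc p) S h k = step S k (λ l q → conditional p (far k S)
    (≤-pred (≤-trans (smaller l q) h)) l)
    where
    smaller : ∀ l → near k S l ≡ true → count (far k S) < count S
    smaller l q = subst (count (far k S) <_) (sym (count-remove l S (∧-trueˡ {S l} q)))
      (s≤s (count-mono (far k S) (remove S l) (λ l' p → remove-intro S l (∧-trueˡ {S l'} p)
        (λ { refl → false≢true (not-true (∧-trueʳ {S l} p)) (∧-trueʳ {S l} q) }))))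

  -- If adding `k` left no good vector, every vector good for the smaller family would lie in `E k`,
  -- giving `E k` conditional probability 1, whereas `conditional` allows at most 2/R ≤ 1/2.
  0<#good : ∀ p S → count S ≡ p → 0 < # (good E S)
  0<#good zero S h = ≤-trans (0<#true {M}) (#-mono (λ _ → true) (good E S) (λ ω _ → every⁺ _
    (λ l → cong not (≢true⇒false {S l ∧ E l ω} (λ p → <⇒≢ (0<count {f = S} l (∧-trueˡ {S l} p)) (sym h))))))
  0<#good (suc p) S h with ∃-of-count S (subst (0 <_) (sym h) (s≤s z≤n))
  ... | k , Sk with 0 <? # (good E S)
  ...   | yes q = q
  ...   | no ¬q = ⊥-elim (<⇒≱ (*-monoˡ-< (# (good E S')) {{ℕ.>-nonZero pos}} (≤-trans (s≤s (s≤s (s≤s z≤n))) 4≤R))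
                    (≤-trans (*-monoʳ-≤ R only-k) (conditional (count S') S' ≤-refl k)))
    where
    S' = remove S k
    pos : 0 < # (good E S')
    pos = 0<#good p S' (cong (_∸ 1) (trans (sym (count-remove k S Sk)) h))
    only-k : # (good E S') ≤ # (λ ω → good E S' ω ∧ E k ω)
    only-k = ≤-trans (≤-reflexive (#-split (good E S') (E k)))
      (≤-trans (+-monoʳ-≤ _ (≤-trans (#-mono _ (good E S) rest) (≮⇒≥ ¬q))) (≤-reflexive (+-identityʳ _)))
      where
      rest : ∀ ω → good E S' ω ∧ not (E k ω) ≡ true → good E S ω ≡ true
      rest ω q with extend S S' (λ l → ⌊ l ≟ k ⌋) cases ω (∧-trueˡ {good E S' ω} q)
        where
        cases : ∀ l → S l ≡ true → S' l ≡ true ⊎ ⌊ l ≟ k ⌋ ≡ true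
        cases l p = helper (l ≟ k)
          where
          helper : Dec (l ≡ k) → S' l ≡ true ⊎ ⌊ l ≟ k ⌋ ≡ true
          helper (yes e) = inj₂ (⇒true {d = l ≟ k} e)
          helper (no ne) = inj₁ (remove-intro S k p ne)
      ... | inj₁ r = r
      ... | inj₂ (l , r , s) = false≢true (not-true (∧-trueʳ {good E S' ω} q))
                                 (subst (λ l → E l ω ≡ true) (true⇒ {d = l ≟ k} r) s)

  local-lemma : ∃ λ ω → ∀ k → E k ω ≡ false
  local-lemma with ∃-of-# (good E (λ _ → true)) (0<#good _ (λ _ → true) refl)
  ... | ω , h = ω , (λ k → not-true (every⁻ _ h k))

-- Random recolouring

some : (Fin n → Bool) → Bool
some f = not (every (not ∘ f))

some⁺ : (f : Fin n → Bool) → ∀ i → f i ≡ true → some f ≡ true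
some⁺ f i p = cong not (≢true⇒false (λ h → false≢true (not-true (every⁻ (not ∘ f) h i)) p))

some⁻ : (f : Fin n → Bool) → some f ≡ true → ∃ λ i → f i ≡ true
some⁻ f h with any? (λ i → f i Bool.≟ true)
... | yes p = p
... | no ¬p = false≢true (not-true h) (every⁺ (not ∘ f) (λ i → cong not (≢true⇒false (λ q → ¬p (i , q)))))

module Coins (n : ℕ) where

  Ω : Set
  Ω = Vec Bool (n * n)

  bit : Ω → Fin n → Fin n → Bool
  bit ω u v = lookup ω (combine u v)

  flip : Fin n → Fin n → Ω → Ω
  flip u v = flipAt (combine u v)

  -- One bit per edge would do, but two make the choice visibly symmetric.
  coin : Ω → Fin n → Fin n → Bool
  coin ω u v = bit ω u v xor bit ω v u

  bit-flip-other : ∀ ω {a b v w} → ¬ (a ≡ v × b ≡ w) → bit (flip v w ω) a b ≡ bit ω a b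
  bit-flip-other ω {a} {b} {v} {w} ne =
    lookup∘updateAt′ (combine a b) (combine v w) (λ e → ne (combine-injective a b v w e)) ω

  coin-sym : ∀ ω u v → coin ω u v ≡ coin ω v u
  coin-sym ω u v = xor-comm (bit ω u v) _

  coin-flip-other : ∀ ω {a b v w} → ¬ (a ≡ v × b ≡ w) → ¬ (b ≡ v × a ≡ w) → coin (flip v w ω) a b ≡ coin ω a b
  coin-flip-other ω p q = cong₂ _xor_ (bit-flip-other ω p) (bit-flip-other ω q)

  coin-flip : ∀ ω {v w} → v ≢ w → coin (flip v w ω) v w ≡ not (coin ω v w)
  coin-flip ω {v} {w} ne = trans
    (cong₂ _xor_ (lookup∘updateAt (combine v w) {not} ω) (bit-flip-other ω (λ (p , _) → ne (sym p))))
    (sym (not-distribˡ-xor (bit ω v w) _))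

edge-≢ : (G : SimpleGraph n) → ∀ {u v} → Edge G u v → u ≢ v
edge-≢ G e refl = false≢true (irrefl G _) e

extraPalette : ∀ {X} → SimpleGraph n → (Fin n → Fin n → Fin X) → (Fin n → Fin n → Bool) → Fin n → Fin X → Bool
extraPalette F x recoloured u i = some (λ z → adj F u z ∧ (⌊ x u z ≟ i ⌋ ∧ recoloured u z))

module Palettes (G F : SimpleGraph n) (X Δ D r : ℕ) (x : Fin n → Fin n → Fin X)
  (degG : ∀ u → degree G u ≤ Δ) (degF : ∀ u → degree F u ≤ D) (degF≥ : ∀ u → suc r ≤ degree F u)
  (2≤r : 2 ≤ r) (slack : 4 * (2 * (suc D * Δ)) ≤ 2 ^ r) where

  open Coins n

  inPalette = extraPalette F x

  agree : Ω → Fin n → Fin n → Fin n → Bool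
  agree ω u v w = not (coin ω v w xor inPalette (coin ω) u (x v w))

  others : Fin n → Fin n → Fin n → Bool
  others u v = remove (adj F v) u

  -- One-sided: the edges of `F` at `v` other than `vu` are tested against the palette at `u`.
  -- Coinciding palettes imply this event, and it leaves the coins at `v` as the only ones to be
  -- tossed.
  bad : Fin n → Fin n → Ω → Bool
  bad u v ω = adj G u v ∧ every (λ w → not (others u v w) ∨ agree ω u v w)

  near : Fin n → Fin n → Bool
  near v z = ⌊ z ≟ v ⌋ ∨ adj F v z

  -- The pairs whose event may read the coin of an edge of `F` at `v`: such an edge has both ends
  -- near `v`, and `bad a b` reads coins at `a` and at `b` only.
  related : Fin n → Fin n → Fin n → Bool
  related v a b = adj G a b ∧ (near v a ∨ near v b)

  inPalette-cong : ∀ {c c'} u i → (∀ z → c u z ≡ c' u z) → inPalette c u i ≡ inPalette c' u i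
  inPalette-cong u i h = cong not (every-cong (λ z → cong (λ b → not (adj F u z ∧ (⌊ x u z ≟ i ⌋ ∧ b))) (h z)))

  inPalette-flip : ∀ ω {u v w} i → u ≢ v → u ≢ w →
                   inPalette (coin (flip v w ω)) u i ≡ inPalette (coin ω) u i
  inPalette-flip ω {u} {v} {w} i p q =
    inPalette-cong {coin (flip v w ω)} {coin ω} u i (λ z → coin-flip-other ω (λ (e , _) → p e) (λ (_ , e) → q e))

  bad-flip : ∀ ω {a b v w} → Edge F v w → related v a b ≡ false → bad a b (flip v w ω) ≡ bad a b ω
  bad-flip ω {a} {b} {v} {w} e h = helper (adj G a b) refl
    where
    helper : ∀ t → adj G a b ≡ t → bad a b (flip v w ω) ≡ bad a b ω
    helper false g rewrite g = refl
    helper true g = cong (adj G a b ∧_) (every-cong (λ z → cong (λ t → not (others a b z) ∨ not t)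
        (cong₂ _xor_ (coin-flip-other ω (λ (p , _) → b≢v p) (λ (_ , p) → b≢w p))
                     (inPalette-flip ω (x b z) a≢v a≢w))))
      where
      far : ∀ {z} → z ≡ v ⊎ z ≡ w → near v z ≡ true
      far {z} (inj₁ p) = ∨-trueˡ (⇒true {d = z ≟ v} p)
      far {z} (inj₂ refl) = ∨-trueʳ {⌊ z ≟ v ⌋} e
      a-far : a ≡ v ⊎ a ≡ w → ⊥
      a-far p = false≢true h (∧-true g (∨-trueˡ (far p)))
      b-far : b ≡ v ⊎ b ≡ w → ⊥
      b-far p = false≢true h (∧-true g (∨-trueʳ {near v a} (far p)))
      a≢v = λ p → a-far (inj₁ p)
      a≢w = λ p → a-far (inj₂ p)
      b≢v = λ p → b-far (inj₁ p)
      b≢w = λ p → b-far (inj₂ p)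

  event : Fin (n * n) → Ω → Bool
  event k = bad (proj₁ (remQuot {n} n k)) (proj₂ (remQuot {n} n k))

  -- Only the second endpoint of `k` matters: the palette at the first is treated as given, and the
  -- randomness spent on the event is in the coins at the second.
  dep : Fin (n * n) → Fin (n * n) → Bool
  dep k l = related (proj₂ (remQuot {n} n k)) (proj₁ (remQuot {n} n l)) (proj₂ (remQuot {n} n l))

  near≤ : ∀ v → count (near v) ≤ suc D
  near≤ v = ≤-trans (count-∨ (λ z → ⌊ z ≟ v ⌋) (adj F v))
    (+-mono-≤ (count-unique _ (λ i j p q → trans (true⇒ {d = i ≟ v} p) (sym (true⇒ {d = j ≟ v} q)))) (degF v))

  -- One end of a related pair is among at most D + 1 vertices near `v`, the other among its at most
  -- Δ neighbours; the factor 2 chooses which end is near, as pairs are ordered.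
  degree≤ : ∀ k → count (dep k) ≤ 2 * (suc D * Δ)
  degree≤ k = begin
    count (dep k)
      ≡⟨ count-combine n (dep k) ⟩
    sum (λ a → count (λ b → dep k (combine {n} a b)))
      ≡⟨ sum-cong-≗ (λ a → count-cong (λ b → cong (λ (a , b) → related v a b) (remQuot-combine {n} a b))) ⟩
    sum (λ a → count (λ b → related v a b))
      ≤⟨ sum-mono (λ a → ≤-trans (≤-reflexive (count-cong (λ b → distrib (adj G a b) (near v a) (near v b))))
                                 (count-∨ (λ b → near v a ∧ adj G a b) (λ b → near v b ∧ adj G a b))) ⟩
    sum (λ a → count (λ b → near v a ∧ adj G a b) + count (λ b → near v b ∧ adj G a b))
      ≡⟨ ∑-distrib-+ {n} (λ a → count (λ b → near v a ∧ adj G a b)) (λ a → count (λ b → near v b ∧ adj G a b)) ⟩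
    sum (λ a → count (λ b → near v a ∧ adj G a b)) + sum (λ a → count (λ b → near v b ∧ adj G a b))
      ≡⟨ cong (sum (λ a → count (λ b → near v a ∧ adj G a b)) +_)
           (trans (∑count-comm {n} {n} (λ a b → near v b ∧ adj G a b))
                  (sum-cong-≗ (λ b → count-cong (λ a → cong (near v b ∧_) (SimpleGraph.sym G a b))))) ⟩
    sum (λ a → count (λ b → near v a ∧ adj G a b)) + sum (λ b → count (λ a → near v b ∧ adj G b a))
      ≤⟨ +-mono-≤ one one ⟩
    suc D * Δ + suc D * Δ
      ≡⟨ cong (suc D * Δ +_) (sym (+-identityʳ _)) ⟩
    2 * (suc D * Δ) ∎
    where
    open ≤-Reasoning
    v = proj₂ (remQuot {n} n k)
    distrib : ∀ p q r → p ∧ (q ∨ r) ≡ (q ∧ p) ∨ (r ∧ p)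
    distrib false false false = refl
    distrib false false true  = refl
    distrib false true  false = refl
    distrib false true  true  = refl
    distrib true  false false = refl
    distrib true  false true  = refl
    distrib true  true  r     = refl
    one : sum (λ a → count (λ b → near v a ∧ adj G a b)) ≤ suc D * Δ
    one = ≤-trans (sum-count-≤ (near v) (adj G) Δ degG) (*-monoˡ-≤ Δ (near≤ v))

  -- Neither `Q` nor the palette at `u` depends on the coins of the edges `vw` of `F` with w ≠ u.
  -- Given `Q`, each such coin therefore agrees with its prescribed value with probability 1/2,
  -- independently of the others.
  unlikely-bad : ∀ u v (Q : Ω → Bool) →
                 (∀ ω w → Edge F v w → Q (flip v w ω) ≡ Q ω) →
                 2 ^ r * # (λ ω → Q ω ∧ bad u v ω) ≤ # Q
  unlikely-bad u v Q hQ = helper (adj G u v) refl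
    where
    helper : ∀ t → adj G u v ≡ t → 2 ^ r * # (λ ω → Q ω ∧ bad u v ω) ≤ # Q
    helper false g = ≤-trans (≤-reflexive (trans (cong (2 ^ r *_) none) (*-zeroʳ (2 ^ r)))) z≤n
      where
      #-none : ∀ {M} → # {M} (λ _ → false) ≡ 0
      #-none {zero} = refl
      #-none {suc M} = cong₂ _+_ (#-none {M}) (#-none {M})
      none : # (λ ω → Q ω ∧ bad u v ω) ≡ 0
      none rewrite g = trans (#-cong (λ ω → ∧-zeroʳ (Q ω))) (#-none {n * n})
    helper true g with enumerate (others u v)
    ... | e , e∈ , e-inj = begin
      2 ^ r * # (λ ω → Q ω ∧ bad u v ω)
        ≤⟨ *-mono-≤ (^-monoʳ-≤ 2 r≤) (#-mono _ _ sub) ⟩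
      2 ^ count (others u v) * # (λ ω → Q ω ∧ every (λ k → agree ω u v (e k)))
        ≡⟨ halvings (count (others u v)) (λ k → combine v (e k)) (λ k ω → agree ω u v (e k)) Q
             (λ k ω → hQ ω (e k) (F-e k)) flips keeps ⟩
      # Q ∎
      where
      open ≤-Reasoning
      F-e : ∀ k → Edge F v (e k)
      F-e k = remove-⊆ (adj F v) u (e∈ k)
      -- The edge `uv` may itself belong to `F` and is then not tested; hence `suc r` in `degF≥`.
      r≤ : r ≤ count (others u v)
      r≤ = ≤-pred (≤-trans (degF≥ v) (count-remove-≤ u (adj F v)))
      sub : ∀ ω → Q ω ∧ bad u v ω ≡ true → Q ω ∧ every (λ k → agree ω u v (e k)) ≡ true
      sub ω p = ∧-true {Q ω} (∧-trueˡ p) (every⁺ _ (λ k → pick (every⁻ _ (∧-trueʳ {adj G u v} (∧-trueʳ {Q ω} p)) (e k)) (e∈ k)))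
        where
        pick : ∀ {s t} → not s ∨ t ≡ true → s ≡ true → t ≡ true
        pick p refl = p
      palette-keeps : ∀ l ω i → inPalette (coin (flip v (e l) ω)) u i ≡ inPalette (coin ω) u i
      palette-keeps l ω i = inPalette-flip ω i (edge-≢ G g) (λ p → remove-≢ (adj F v) u (e∈ l) (sym p))
      flips : ∀ k ω → agree (flip v (e k) ω) u v (e k) ≡ not (agree ω u v (e k))
      flips k ω = cong not (trans
        (cong₂ _xor_ (coin-flip ω {v} {e k} (edge-≢ F (F-e k))) (palette-keeps k ω (x v (e k))))
        (sym (not-distribˡ-xor (coin ω v (e k)) _)))
      keeps : ∀ k l ω → k ≢ l → agree (flip v (e l) ω) u v (e k) ≡ agree ω u v (e k)
      keeps k l ω ne = cong not (cong₂ _xor_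
        (coin-flip-other ω (λ (_ , p) → ne (e-inj k l p)) (λ (_ , p) → edge-≢ F (F-e l) p))
        (palette-keeps l ω (x v (e k))))

  unlikely : ∀ k S → (∀ l → S l ≡ true → dep k l ≡ false) →
             2 ^ r * # (λ ω → good event S ω ∧ event k ω) ≤ # (good event S)
  unlikely k S h = unlikely-bad _ _ (good event S) (λ ω w e → every-cong (λ l → cong not (invariant ω w e l)))
    where
    invariant : ∀ ω w → Edge F (proj₂ (remQuot {n} n k)) w → ∀ l →
                S l ∧ event l (flip (proj₂ (remQuot {n} n k)) w ω) ≡ S l ∧ event l ω
    invariant ω w e l with S l in s
    ... | false = refl
    ... | true  = bad-flip ω e (h l s)

  4≤2^r : 4 ≤ 2 ^ r
  4≤2^r = ^-monoʳ-≤ 2 2≤r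

  open LocalLemma event dep (2 ^ r) (2 * (suc D * Δ)) 4≤2^r slack degree≤ unlikely using (local-lemma)

  distinguishing : ∃ λ (c : Fin n → Fin n → Bool) → (∀ u v → c u v ≡ c v u) ×
    (∀ u v → Edge G u v → ∃ λ w → Edge F v w × w ≢ u × c v w ≢ inPalette c u (x v w))
  distinguishing with local-lemma
  ... | ω , ok = coin ω , coin-sym ω , find
    where
    not-bad : ∀ u v → bad u v ω ≡ false
    not-bad u v = trans (cong (λ (u , v) → bad u v ω) (sym (remQuot-combine {n} u v))) (ok (combine u v))
    find : ∀ u v → Edge G u v → ∃ λ w → Edge F v w × w ≢ u × coin ω v w ≢ inPalette (coin ω) u (x v w)
    find u v g with any? (λ w → (not (others u v w) ∨ agree ω u v w) Bool.≟ false)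
    ... | no none = false≢true (not-bad u v) (∧-true g (every⁺ _ (λ w → helper w)))
      where
      helper : ∀ w → not (others u v w) ∨ agree ω u v w ≡ true
      helper w with not (others u v w) ∨ agree ω u v w in e
      ... | true  = refl
      ... | false = ⊥-elim (none (w , e))
    ... | yes (w , p) with others u v w in o
    ...   | true = w , remove-⊆ (adj F v) u o , remove-≢ (adj F v) u o
               , (λ q → false≢true p (cong not (trans (cong (_xor inPalette (coin ω) u (x v w)) q) (xor-same (inPalette (coin ω) u (x v w))))))
    find u v g | yes (w , ()) | false

-- From differing palettes to satisfied edges

module Recolour (G F : SimpleGraph n) {C X : ℕ} (F⊆G : ∀ {u v} → Edge F u v → Edge G u v)
  (c : Fin n → Fin n → Fin C) (c-sym : IsEdgeColouring G c) (c-proper : IsProper G c)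
  (x : Fin n → Fin n → Fin X) (x-sym : IsEdgeColouring F x) (x-proper : IsProper F x)
  (coin : Fin n → Fin n → Bool) (coin-sym : ∀ u v → coin u v ≡ coin v u) where

  inPalette = extraPalette F x coin

  moved : Fin n → Fin n → Bool
  moved u v = adj F u v ∧ coin u v

  moved-sym : ∀ u v → moved u v ≡ moved v u
  moved-sym u v = cong₂ _∧_ (SimpleGraph.sym F u v) (coin-sym u v)

  new : Fin n → Fin n → Fin (C + X)
  new u v = if moved u v then C ↑ʳ x u v else c u v ↑ˡ X

  ↑ˡ≢↑ʳ : ∀ (i : Fin C) (j : Fin X) → i ↑ˡ X ≢ C ↑ʳ j
  ↑ˡ≢↑ʳ i j e with trans (sym (splitAt-↑ˡ C i X)) (trans (cong (Fin.splitAt C) e) (splitAt-↑ʳ C X j))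
  ... | ()

  new-extra : ∀ {u v j} → new u v ≡ C ↑ʳ j → moved u v ≡ true × x u v ≡ j
  new-extra {u} {v} {j} e with moved u v
  ... | true  = refl , ↑ʳ-injective C (x u v) j e
  ... | false = ⊥-elim (↑ˡ≢↑ʳ (c u v) j e)

  extra-new : ∀ {u v} → moved u v ≡ true → new u v ≡ C ↑ʳ x u v
  extra-new p rewrite p = refl

  x-unique : ∀ {u v w} → Edge F u v → Edge F u w → x u v ≡ x u w → v ≡ w
  x-unique {u} {v} {w} e f h with v ≟ w
  ... | yes r = r
  ... | no r  = ⊥-elim (x-proper u v w e f r h)

  new-sym : IsEdgeColouring G new
  new-sym u v e with moved u v in p | moved v u in q
  ... | true  | true  = cong (C ↑ʳ_) (x-sym u v (∧-trueˡ p))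
  ... | false | false = cong (_↑ˡ X) (c-sym u v e)
  ... | true  | false = false≢true q (trans (moved-sym v u) p)
  ... | false | true  = false≢true p (trans (moved-sym u v) q)

  new-proper : IsProper G new
  new-proper u v w e f ne h with moved u v in p | moved u w in q
  ... | true  | true  = x-proper u v w (∧-trueˡ p) (∧-trueˡ q) ne (↑ʳ-injective C _ _ h)
  ... | false | false = c-proper u v w e f ne (↑ˡ-injective X _ _ h)
  ... | true  | false = ↑ˡ≢↑ʳ _ _ (sym h)
  ... | false | true  = ↑ˡ≢↑ʳ _ _ h

  module _ {u v w : Fin n} (uv : Edge G u v) (vw : Edge F v w) (w≢u : w ≢ u) where

    at : Fin n → Fin n → Fin n → Bool
    at a b z = not ⌊ z ≟ b ⌋ ∧ adj G a z ∧ ⌊ new a z ≟ C ↑ʳ x v w ⌋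

    at⁻ : ∀ {a b z} → at a b z ≡ true → moved a z ≡ true × x a z ≡ x v w
    at⁻ {a} {b} {z} p = new-extra (true⇒ {d = new a z ≟ C ↑ʳ x v w} (∧-trueʳ {adj G a z} (∧-trueʳ {not ⌊ z ≟ b ⌋} p)))

    at⁺ : ∀ {a b z} → z ≢ b → moved a z ≡ true → x a z ≡ x v w → at a b z ≡ true
    at⁺ {a} {b} {z} ne p e = ∧-true (cong not (⇒false {d = z ≟ b} ne)) (∧-true (F⊆G (∧-trueˡ p))
      (⇒true {d = new a z ≟ C ↑ʳ x v w} (trans (extra-new p) (cong (C ↑ʳ_) e))))

    v-only-w : ∀ {z} → at v u z ≡ true → z ≡ w
    v-only-w p = let (m , e) = at⁻ {v} {u} p in x-unique (∧-trueˡ m) vw e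

    in-palette : ∀ z → at u v z ≡ true → inPalette u (x v w) ≡ true
    in-palette z p = let (m , e) = at⁻ {u} {v} p in
      some⁺ _ z (∧-true {adj F u z} (∧-trueˡ m) (∧-true (⇒true {d = x u z ≟ x v w} e) (∧-trueʳ {adj F u z} m)))

    -- As `x` is proper, the extra colour of `vw` occurs at most once at each end, and at `v` only
    -- on `vw`. The inequality says that exactly one end contributes: `v` if `vw` is moved,
    -- otherwise `u`.
    satisfied : coin v w ≢ inPalette u (x v w) → colourCount G new u v (C ↑ʳ x v w) ≡ 1
    satisfied differ with coin v w in vw-coin | inPalette u (x v w) in u-pal
    ... | true  | true  = ⊥-elim (differ refl)
    ... | false | false = ⊥-elim (differ refl)
    ... | true  | false = cong₂ _+_
      (count-none {f = at u v} (λ z → ≢true⇒false (λ p → false≢true u-pal (in-palette z p))))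
      (count≡1 (at v u) w (at⁺ w≢u (∧-true vw vw-coin) refl) (λ z → v-only-w {z}))
    ... | false | true  = cong₂ _+_ first
      (count-none {f = at v u} (λ z → ≢true⇒false (λ p → false≢true vw-coin
        (∧-trueʳ {adj F v w} (subst (λ z → moved v z ≡ true) (v-only-w {z} p) (proj₁ (at⁻ {v} {u} p)))))))
      where
      first : count (at u v) ≡ 1
      first with some⁻ _ u-pal
      ... | z , p = count≡1 (at u v) z (at⁺ z≢v (∧-true uz z-coin) xz)
              (λ z' q → let (m , e) = at⁻ {u} {v} q in x-unique (∧-trueˡ m) uz (trans e (sym xz)))
        where
        uz = ∧-trueˡ p
        xz = true⇒ {d = x u z ≟ x v w} (∧-trueˡ {⌊ x u z ≟ x v w ⌋} (∧-trueʳ {adj F u z} p))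
        z-coin = ∧-trueʳ {⌊ x u z ≟ x v w ⌋} (∧-trueʳ {adj F u z} p)
        -- The occurrence at `u` must not be `uv`, which is excluded from the neighbourhood:
        -- otherwise `vu` and `vw` would share a colour of `x`, forcing w = u.
        z≢v : z ≢ v
        z≢v refl = w≢u (sym (x-unique (trans (SimpleGraph.sym F z u) uz) vw (trans (sym (x-sym u z uz)) xz)))

  recoloured : (∀ u v → Edge G u v → ∃ λ w → Edge F v w × w ≢ u × coin v w ≢ inPalette u (x v w)) →
               POCFColourable G (C + X)
  recoloured dist = new , new-sym , new-proper , λ u v e _ →
    let (w , vw , w≢u , differ) = dist u v e in C ↑ʳ x v w , satisfied e vw w≢u differ

-- Parameters

scale : ∀ Δ fuel s → 2 ^ (3 * s + 3) ≤ Δ → Δ < 2 ^ (3 * (fuel + s) + 3) →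
        ∃ λ s' → s ≤ s' × 2 ^ (3 * s' + 3) ≤ Δ × Δ < 2 ^ (3 * suc s' + 3)
scale Δ zero s lo hi = ⊥-elim (<⇒≱ hi lo)
scale Δ (suc fuel) s lo hi with 2 ^ (3 * suc s + 3) ≤? Δ
... | no p = s , ≤-refl , lo , ≰⇒> p
... | yes p with scale Δ fuel (suc s) p (subst (λ a → Δ < 2 ^ (3 * a + 3)) (sym (+-suc fuel s)) hi)
...   | s' , q , r = s' , ≤-trans (n≤1+n s) q , r

n<2^n : ∀ n → n < 2 ^ n
n<2^n zero = s≤s z≤n
n<2^n (suc n) = subst (suc (suc n) ≤_) (cong (2 ^ n +_) (sym (+-identityʳ _))) (+-mono-≤ (≤-trans (s≤s z≤n) (n<2^n n)) (n<2^n n))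

-- `Slack₁` is the condition 4d ≤ 2^r of the local lemma after Δ is replaced by 2^(3s+6); 1024 is 16
-- · 2^6, and s = 17 is the first value from which it holds throughout. `Slack₂` makes Δ exceed
-- 64(3s+6)², as `two-thirds` requires.
Slack₁ Slack₂ : ℕ → Set
Slack₁ s = (6 * s + 4) * 1024 ≤ 2 ^ s
Slack₂ s = (3 * s + 6) * (3 * s + 6) * 64 < 2 ^ (3 * s + 3)

slack₁ : ∀ j → Slack₁ (j + 17)
slack₁ zero = ≤ᵇ⇒≤ _ _ _
slack₁ (suc j) = begin
  (6 * suc s + 4) * 1024     ≤⟨ *-monoˡ-≤ 1024 (≤-trans (m≤m+n (6 * suc s + 4) (6 * j + 100)) (≤-reflexive (ar j))) ⟩
  (2 * (6 * s + 4)) * 1024   ≡⟨ *-assoc 2 (6 * s + 4) 1024 ⟩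
  2 * ((6 * s + 4) * 1024)   ≤⟨ *-monoʳ-≤ 2 (slack₁ j) ⟩
  2 * 2 ^ s ∎
  where
  open ≤-Reasoning
  s = j + 17
  ar : ∀ j → 6 * suc (j + 17) + 4 + (6 * j + 100) ≡ 2 * (6 * (j + 17) + 4)
  ar = solve-∀

slack₂ : ∀ j → Slack₂ (j + 17)
slack₂ zero = <ᵇ⇒< _ _ _
slack₂ (suc j) = begin-strict
  (3 * suc s + 6) * (3 * suc s + 6) * 64     ≤⟨ *-monoˡ-≤ 64 (*-mono-≤ double double) ⟩
  (2 * a) * (2 * a) * 64                     ≡⟨ ar₂ a ⟩
  4 * (a * a * 64)                           <⟨ *-monoʳ-< 4 (slack₂ j) ⟩
  4 * 2 ^ (3 * s + 3)                        ≤⟨ *-monoˡ-≤ (2 ^ (3 * s + 3)) {4} {8} (≤ᵇ⇒≤ _ _ _) ⟩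
  2 ^ 3 * 2 ^ (3 * s + 3)                    ≡⟨ sym (^-distribˡ-+-* 2 3 (3 * s + 3)) ⟩
  2 ^ (3 + (3 * s + 3))                      ≡⟨ cong (2 ^_) (ar₃ s) ⟩
  2 ^ (3 * suc s + 3)                        ∎
  where
  open ≤-Reasoning
  s = j + 17
  a = 3 * s + 6
  ar₁ : ∀ s → 3 * suc s + 6 + (3 * s + 3) ≡ 2 * (3 * s + 6)
  ar₁ = solve-∀
  double : 3 * suc s + 6 ≤ 2 * a
  double = ≤-trans (m≤m+n (3 * suc s + 6) (3 * s + 3)) (≤-reflexive (ar₁ s))
  ar₂ : ∀ a → (2 * a) * (2 * a) * 64 ≡ 4 * (a * a * 64)
  ar₂ = solve-∀
  ar₃ : ∀ s → 3 + (3 * s + 3) ≡ 3 * suc s + 3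
  ar₃ = solve-∀

-- As Δ < 2^(3s+6), testing the hypothesis at the rational (3s+6)/1 gives (Δ - δ)² ≤ 4Δ(3s+6)². If δ
-- < 2m, then Δ - δ ≥ Δ/4, so that Δ²/16 ≤ 4Δ(3s+6)², against `Slack₂`.
two-thirds : ∀ s Δ δ m → Slack₂ s → 2 ^ (3 * s + 3) ≤ Δ → Δ < 2 ^ (3 * suc s + 3) →
             MinDegreeCond Δ δ → 3 * m ≤ Δ + 2 → 2 * m ≤ δ
two-thirds s Δ δ m slack lo hi cond 3m≤ = ≮⇒≥ (λ δ<2m → <⇒≱ hi
    (subst (2 ^ (3 * suc s + 3) ≤_) (*-identityʳ Δ) (cond (3 * suc s + 3) 1 (s≤s z≤n) (violated δ<2m))))
  where
  open ≤-Reasoning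
  a = 3 * suc s + 3
  gap = Δ ∸ δ
  Q = (3 * s + 6) * (3 * s + 6) * 64
  Q<Δ : Q < Δ
  Q<Δ = <-≤-trans slack lo
  4≤Δ : 4 ≤ Δ
  4≤Δ = ≤-trans (^-monoʳ-≤ 2 {2} {3 * s + 3} (≤-trans (s≤s (s≤s z≤n)) (m≤n+m 3 (3 * s)))) lo
  module _ (δ<2m : δ < 2 * m) where
    3δ≤ : 3 * δ ≤ 2 * Δ + 1
    3δ≤ = +-cancelʳ-≤ 3 _ _ (begin
      3 * δ + 3       ≡⟨ ar₁ δ ⟩
      3 * suc δ       ≤⟨ *-monoʳ-≤ 3 δ<2m ⟩
      3 * (2 * m)     ≡⟨ ar₂ m ⟩
      2 * (3 * m)     ≤⟨ *-monoʳ-≤ 2 3m≤ ⟩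
      2 * (Δ + 2)     ≡⟨ ar₃ Δ ⟩
      2 * Δ + 1 + 3   ∎)
      where
      ar₁ : ∀ δ → 3 * δ + 3 ≡ 3 * suc δ
      ar₁ = solve-∀
      ar₂ : ∀ m → 3 * (2 * m) ≡ 2 * (3 * m)
      ar₂ = solve-∀
      ar₃ : ∀ Δ → 2 * (Δ + 2) ≡ 2 * Δ + 1 + 3
      ar₃ = solve-∀
    4δ≤3Δ : 4 * δ ≤ 3 * Δ
    4δ≤3Δ = *-cancelˡ-≤ 3 (begin
      3 * (4 * δ)       ≡⟨ ar₁ δ ⟩
      4 * (3 * δ)       ≤⟨ *-monoʳ-≤ 4 3δ≤ ⟩
      4 * (2 * Δ + 1)   ≡⟨ ar₂ Δ ⟩
      8 * Δ + 4         ≤⟨ +-monoʳ-≤ (8 * Δ) 4≤Δ ⟩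
      8 * Δ + Δ         ≡⟨ ar₃ Δ ⟩
      3 * (3 * Δ)       ∎)
      where
      ar₁ : ∀ δ → 3 * (4 * δ) ≡ 4 * (3 * δ)
      ar₁ = solve-∀
      ar₂ : ∀ Δ → 4 * (2 * Δ + 1) ≡ 8 * Δ + 4
      ar₂ = solve-∀
      ar₃ : ∀ Δ → 8 * Δ + Δ ≡ 3 * (3 * Δ)
      ar₃ = solve-∀
    Δ≤4gap : Δ ≤ 4 * gap
    Δ≤4gap = begin
      Δ                   ≡⟨ sym (m+n∸n≡m Δ (3 * Δ)) ⟩
      4 * Δ ∸ 3 * Δ       ≤⟨ ∸-monoʳ-≤ (4 * Δ) 4δ≤3Δ ⟩
      4 * Δ ∸ 4 * δ       ≡⟨ sym (*-distribˡ-∸ 4 Δ δ) ⟩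
      4 * gap               ∎
    violated : 4 * Δ * (a * a) < (gap * gap) * (1 * 1)
    violated = *-cancelˡ-< 16 _ _ (begin-strict
      16 * (4 * Δ * (a * a))     ≡⟨ ar₁ Δ s ⟩
      Δ * Q                      <⟨ *-monoʳ-< Δ {{ℕ.>-nonZero (≤-trans (s≤s z≤n) 4≤Δ)}} Q<Δ ⟩
      Δ * Δ                      ≤⟨ *-mono-≤ Δ≤4gap Δ≤4gap ⟩
      (4 * gap) * (4 * gap)          ≡⟨ ar₂ gap ⟩
      16 * (gap * gap * (1 * 1))     ∎)
      where
      ar₁ : ∀ Δ s → 16 * (4 * Δ * ((3 * suc s + 3) * (3 * suc s + 3))) ≡ Δ * ((3 * s + 6) * (3 * s + 6) * 64)
      ar₁ = solve-∀
      ar₂ : ∀ t → (4 * t) * (4 * t) ≡ 16 * (t * t * (1 * 1))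
      ar₂ = solve-∀

-- With 2^(3s+3) ≤ Δ < 2^(3s+6), the parameters are t = 2s (so degrees in F lie between 4s and 6s + 3)
-- and 6s + 4 extra colours.
colourable : ∀ {n} (G : SimpleGraph n) s Δ δ → 1 ≤ s → Slack₁ s → Slack₂ s →
             2 ^ (3 * s + 3) ≤ Δ → Δ < 2 ^ (3 * suc s + 3) →
             (∀ u → degree G u ≤ Δ) → (∀ u → δ ≤ degree G u) → MinDegreeCond Δ δ →
             POCFColourable G (suc Δ + suc (3 * suc (2 * s)))
colourable {n} G s Δ δ 1≤s sl₁ sl₂ lo hi degG degG≥ cond =
  main (sparse-subgraph G size (2 * s) 2s≤m
         (λ u → ≤-trans (two-thirds s Δ δ size sl₂ lo hi cond 3m≤) (degG≥ u))
         (λ u → ≤-trans (degG u) Δ≤3m))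
       (vizing G Δ degG)
  where
  open ≤-Reasoning
  -- This is Δ/3 rounded up, so that three blocks of this size can hold a full neighbourhood.
  size = (Δ + 2) ℕ./ 3
  div : Δ + 2 ≡ (Δ + 2) ℕ.% 3 + size * 3
  div = m≡m%n+[m/n]*n (Δ + 2) 3
  3m≤ : 3 * size ≤ Δ + 2
  3m≤ = begin
    3 * size                  ≡⟨ *-comm 3 size ⟩
    size * 3                  ≤⟨ m≤n+m (size * 3) _ ⟩
    (Δ + 2) ℕ.% 3 + size * 3  ≡⟨ sym div ⟩
    Δ + 2                  ∎
  Δ≤3m : Δ ≤ 3 * size
  Δ≤3m = +-cancelʳ-≤ 2 Δ (3 * size) (begin
    Δ + 2                  ≡⟨ div ⟩
    (Δ + 2) ℕ.% 3 + size * 3  ≤⟨ +-monoˡ-≤ (size * 3) (≤-pred (m%n<n (Δ + 2) 3)) ⟩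
    2 + size * 3              ≡⟨ ar size ⟩
    3 * size + 2              ∎)
    where
    ar : ∀ k → 2 + k * 3 ≡ 3 * k + 2
    ar = solve-∀
  2s≤m : 2 * s ≤ size
  2s≤m = *-cancelˡ-≤ 3 (begin
    3 * (2 * s)            ≤⟨ m≤m+n _ (9 * s * s + 30 * s + 36) ⟩
    3 * (2 * s) + (9 * s * s + 30 * s + 36) ≡⟨ ar s ⟩
    (3 * s + 6) * (3 * s + 6) ≤⟨ m≤m*n ((3 * s + 6) * (3 * s + 6)) 64 ⟩
    (3 * s + 6) * (3 * s + 6) * 64 ≤⟨ <⇒≤ sl₂ ⟩
    2 ^ (3 * s + 3)        ≤⟨ lo ⟩
    Δ                      ≤⟨ Δ≤3m ⟩
    3 * size                  ∎)
    where
    ar : ∀ s → 3 * (2 * s) + (9 * s * s + 30 * s + 36) ≡ (3 * s + 6) * (3 * s + 6)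
    ar = solve-∀
  D = 3 * suc (2 * s)
  -- Degrees in `F` are at least 4s, and one edge at `v` may be lost to `uv`.
  r = 4 * s ∸ 1
  suc-r : suc r ≡ 4 * s
  suc-r = m+[n∸m]≡n {1} {4 * s} (≤-trans 1≤s (m≤m+n s _))
  2≤r : 2 ≤ r
  2≤r = ≤-pred (subst (3 ≤_) (sym suc-r) (≤-trans (n≤1+n 3) (*-monoʳ-≤ 4 1≤s)))
  slack : 4 * (2 * (suc D * Δ)) ≤ 2 ^ r
  slack = *-cancelˡ-≤ 2 (begin
    2 * (4 * (2 * (suc D * Δ)))              ≡⟨ ar₁ s Δ ⟩
    (6 * s + 4) * 16 * Δ                     ≤⟨ *-monoʳ-≤ ((6 * s + 4) * 16) (<⇒≤ hi) ⟩
    (6 * s + 4) * 16 * 2 ^ (3 * suc s + 3)   ≡⟨ cong (λ e → (6 * s + 4) * 16 * 2 ^ e) (ar₂ s) ⟩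
    (6 * s + 4) * 16 * 2 ^ (3 * s + 6)       ≡⟨ cong ((6 * s + 4) * 16 *_) (^-distribˡ-+-* 2 (3 * s) 6) ⟩
    (6 * s + 4) * 16 * (2 ^ (3 * s) * 64)    ≡⟨ ar₃ (6 * s + 4) (2 ^ (3 * s)) ⟩
    (6 * s + 4) * 1024 * 2 ^ (3 * s)         ≤⟨ *-monoˡ-≤ (2 ^ (3 * s)) sl₁ ⟩
    2 ^ s * 2 ^ (3 * s)                      ≡⟨ sym (^-distribˡ-+-* 2 s (3 * s)) ⟩
    2 ^ (4 * s)                              ≡⟨ cong (2 ^_) (sym suc-r) ⟩
    2 * 2 ^ r                                ∎)
    where
    ar₁ : ∀ s Δ → 2 * (4 * (2 * (suc (3 * suc (2 * s)) * Δ))) ≡ (6 * s + 4) * 16 * Δ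
    ar₁ = solve-∀
    ar₂ : ∀ s → 3 * suc s + 3 ≡ 3 * s + 6
    ar₂ = solve-∀
    ar₃ : ∀ a b → a * 16 * (b * 64) ≡ a * 1024 * b
    ar₃ = solve-∀
  main : (∃ λ (F : SimpleGraph n) → (∀ {u v} → Edge F u v → Edge G u v) ×
           (∀ u → 2 * (2 * s) ≤ degree F u) × (∀ u → degree F u ≤ D)) →
         (∃ λ (c : Fin n → Fin n → Fin (suc Δ)) → IsEdgeColouring G c × IsProper G c) →
         POCFColourable G (suc Δ + suc D)
  main (F , F⊆G , degF≥ , degF) (c , c-sym , c-proper) = extra (vizing F D degF)
    where
    extra : (∃ λ (x : Fin n → Fin n → Fin (suc D)) → IsEdgeColouring F x × IsProper F x) →
            POCFColourable G (suc Δ + suc D)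
    extra (x , x-sym , x-proper) = final distinguishing
      where
      open Palettes G F (suc D) Δ D r x degG degF
        (λ u → subst (_≤ degree F u) (trans (sym (*-assoc 2 2 s)) (sym suc-r)) (degF≥ u)) 2≤r slack
        using (distinguishing)
      final : (∃ λ (coin : Fin n → Fin n → Bool) → (∀ u v → coin u v ≡ coin v u) ×
                (∀ u v → Edge G u v → ∃ λ w → Edge F v w × w ≢ u × coin v w ≢ extraPalette F x coin u (x v w))) →
              POCFColourable G (suc Δ + suc D)
      final (coin , coin-sym , dist) =
        Recolour.recoloured G F F⊆G c c-sym c-proper x x-sym x-proper coin coin-sym dist

-- The excess over Δ is 1 + (6s + 4) = 6s + 5, one less than 2(3s + 3), which is at most 2 log₂ Δ.
within-bound : ∀ s Δ → 2 ^ (3 * s + 3) ≤ Δ → WithinBound Δ (suc Δ + suc (3 * suc (2 * s)))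
within-bound s Δ lo = begin
  2 ^ (suc Δ + suc (3 * suc (2 * s)) ∸ Δ)     ≡⟨ cong (2 ^_) (trans (cong (_∸ Δ) (ar₁ s Δ)) (m+n∸m≡n Δ (6 * s + 5))) ⟩
  2 ^ (6 * s + 5)                             ≤⟨ ^-monoʳ-≤ 2 (≤-trans (n≤1+n _) (≤-reflexive (ar₂ s))) ⟩
  2 ^ ((3 * s + 3) * 2)                       ≡⟨ sym (^-*-assoc 2 (3 * s + 3) 2) ⟩
  (2 ^ (3 * s + 3)) ^ 2                       ≤⟨ ^-monoˡ-≤ 2 lo ⟩
  Δ ^ 2                                       ∎
  where
  open ≤-Reasoning
  ar₁ : ∀ s Δ → suc Δ + suc (3 * suc (2 * s)) ≡ Δ + (6 * s + 5)
  ar₁ = solve-∀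
  ar₂ : ∀ s → suc (6 * s + 5) ≡ (3 * s + 3) * 2
  ar₂ = solve-∀

theorem12 : ∃ λ Δ₀ → ∀ (n : ℕ) (G : SimpleGraph n) (Δ δ : ℕ) → IsMaxDegree G Δ → IsMinDegree G δ → Δ₀ ≤ Δ → MinDegreeCond Δ δ → ∃ λ k → WithinBound Δ k × POCFColourable G k
theorem12 = 2 ^ (3 * 17 + 3) , λ n G Δ δ (_ , degG) (_ , degG≥) large cond →
  -- Searching upwards from 17, Δ steps suffice because Δ < 2^Δ.
  let (s , 17≤s , lo , hi) = scale Δ Δ 17 large (<-trans (n<2^n Δ) (^-monoʳ-< 2 (s≤s (s≤s z≤n)) (exponent Δ)))
      j = s ∸ 17
      s≡ = m∸n+n≡m 17≤s
  in suc Δ + suc (3 * suc (2 * s)) , within-bound s Δ lo ,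
     colourable G s Δ δ (≤-trans (s≤s z≤n) 17≤s) (subst Slack₁ s≡ (slack₁ j)) (subst Slack₂ s≡ (slack₂ j))
       lo hi degG degG≥ cond
  where
  exponent : ∀ Δ → Δ < 3 * (Δ + 17) + 3
  exponent Δ = ≤-trans (m≤m+n (suc Δ) (2 * Δ + 53)) (≤-reflexive (ar Δ))
    where
    ar : ∀ Δ → suc Δ + (2 * Δ + 53) ≡ 3 * (Δ + 17) + 3
    ar = solve-∀
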